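{- There is an algorithm which, given a cograph $G$ with $n$ vertices, computes the exact number of perfect matchings of $G$ in time $O(n^4)$.
   Context: For vertex-disjoint graphs $G=(V,E)$, $H=(W,F)$, the disjoint union is $(V\cup W,E\cup F)$ and the complete join is $(V\cup W,E\cup F\cup\{vw: v\in V,w\in W\})$. A cograph is a graph that is either a single vertex, or the disjoint union of two cographs, or the complete join of two cographs. Time is measured with arithmetic operations on integers counted at unit cost. -}

module Defs where

open import Data.Bool using (Bool; true; false; not; _∧_; if_then_else_; T?)
open import Data.Fin using (Fin; toℕ; fromℕ<; remQuot; _≟_; _<?_)
open import Data.Fin.Properties using (all?)
open import Data.Integer as ℤ using (ℤ; +_; -[1+_])
import Data.Integer.Properties as ℤ
open import Data.List
  using (List; []; _∷_; _++_; map; filter; length; allFin; cartesianProduct)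
open import Data.Nat as ℕ using (ℕ; zero; suc; _≤_)
open import Data.Product using (∃₂; _×_; _,_; uncurry)
open import Data.Sum using (_⊎_; inj₁; inj₂)
open import Data.Unit using (⊤)
open import Function.Bundles using (_↔_; Inverse)
open import Relation.Binary.Definitions using (DecidableEquality)
open import Relation.Binary.PropositionalEquality using (_≡_; refl)
open import Relation.Nullary using (Dec; yes; no)
open import Relation.Nullary.Decidable using (⌊_⌋; _⊎-dec_; _×-dec_)

------------------------------------------------------------------------
-- Simple graphs and cographs

record Graph (V : Set) : Set where
  field
    adj    : V → V → Bool
    symm   : ∀ u v → adj u v ≡ adj v u
    irrefl : ∀ v → adj v v ≡ false

open Graph public

record _≅_ {V W : Set} (G : Graph V) (H : Graph W) : Set where
  field
    vertices : V ↔ W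
    adj-pres : ∀ u v →
      adj G u v ≡ adj H (Inverse.to vertices u) (Inverse.to vertices v)

K₁ : Graph ⊤
K₁ = record { adj = λ _ _ → false ; symm = λ _ _ → refl ; irrefl = λ _ → refl }

-- `sum false` is the disjoint union, `sum true` the complete join: the Boolean
-- says whether vertices from different summands are adjacent.
sum : Bool → {V W : Set} → Graph V → Graph W → Graph (V ⊎ W)
sum b {V} {W} G H = record { adj = a ; symm = s ; irrefl = i }
  where
  a : V ⊎ W → V ⊎ W → Bool
  a (inj₁ u) (inj₁ v) = adj G u v
  a (inj₁ _) (inj₂ _) = b
  a (inj₂ _) (inj₁ _) = b
  a (inj₂ u) (inj₂ v) = adj H u v
  s : ∀ x y → a x y ≡ a y x
  s (inj₁ u) (inj₁ v) = symm G u v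
  s (inj₁ _) (inj₂ _) = refl
  s (inj₂ _) (inj₁ _) = refl
  s (inj₂ u) (inj₂ v) = symm H u v
  i : ∀ x → a x x ≡ false
  i (inj₁ v) = irrefl G v
  i (inj₂ v) = irrefl H v

disjointUnion completeJoin : {V W : Set} → Graph V → Graph W → Graph (V ⊎ W)
disjointUnion = sum false
completeJoin  = sum true

-- `relabel` accounts for the vertex set of an actual graph not being literally
-- ⊤ or a tagged sum.
data Cograph : {V : Set} → Graph V → Set₁ where
  single  : Cograph K₁
  union   : {V W : Set} {G : Graph V} {H : Graph W} →
            Cograph G → Cograph H → Cograph (disjointUnion G H)
  join    : {V W : Set} {G : Graph V} {H : Graph W} →
            Cograph G → Cograph H → Cograph (completeJoin G H)
  relabel : {V W : Set} {G : Graph V} {H : Graph W} →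
            G ≅ H → Cograph G → Cograph H

------------------------------------------------------------------------
-- Perfect matchings

Edge : ℕ → Set
Edge n = Fin n × Fin n

-- Every undirected edge {i , j} is listed once, as the pair with i < j.
edges : ∀ {n} → Graph (Fin n) → List (Edge n)
edges {n} G =
  filter (λ (i , j) → (i <? j) ×-dec T? (adj G i j))
         (cartesianProduct (allFin n) (allFin n))

Incident : ∀ {n} → Fin n → Edge n → Set
Incident v (i , j) = v ≡ i ⊎ v ≡ j

incident? : ∀ {n} (v : Fin n) (e : Edge n) → Dec (Incident v e)
incident? v (i , j) = (v ≟ i) ⊎-dec (v ≟ j)

CoversOnce : ∀ {n} → List (Edge n) → Set
CoversOnce M = ∀ v → length (filter (incident? v) M) ≡ 1

coversOnce? : ∀ {n} (M : List (Edge n)) → Dec (CoversOnce M)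
coversOnce? M = all? (λ v → length (filter (incident? v) M) ℕ.≟ 1)

-- On a list without repetitions, such as `edges G`, this lists every subset
-- exactly once.
sublists : {A : Set} → List A → List (List A)
sublists []       = [] ∷ []
sublists (x ∷ xs) = map (x ∷_) (sublists xs) ++ sublists xs

perfectMatchings : ∀ {n} → Graph (Fin n) → List (List (Edge n))
perfectMatchings G = filter coversOnce? (sublists (edges G))

------------------------------------------------------------------------
-- Unit-cost integer programs

-- A state has integer variables and one-dimensional integer arrays, both named
-- by natural numbers; a program mentions only finitely many of them.

record State : Set where
  constructor mkState
  field
    var : ℕ → ℤ
    arr : ℕ → ℤ → ℤ

open State public

update : {A B : Set} → DecidableEquality A → (A → B) → A → B → A → B
update _≟ᴬ_ f a b x = if ⌊ x ≟ᴬ a ⌋ then b else f x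

setVar : ℕ → ℤ → State → State
setVar x z s = mkState (update ℕ._≟_ (var s) x z) (arr s)

setArr : ℕ → ℤ → ℤ → State → State
setArr a i z s =
  mkState (var s) (update ℕ._≟_ (arr s) a (update ℤ._≟_ (arr s a) i z))

infixl 7 _⊗_
infixl 6 _⊕_ _⊖_
infixr 8 _‼_
infix  4 _≤ₑ_ _=ₑ_
infix  3 _[_]≔_ _≔_
infixr 2 _⨟_

data Expr : Set where
  lit         : ℤ → Expr
  `_          : ℕ → Expr
  _‼_         : ℕ → Expr → Expr
  _⊕_ _⊖_ _⊗_ : Expr → Expr → Expr

data Test : Set where
  _≤ₑ_ _=ₑ_ : Expr → Expr → Test
  notₑ      : Test → Test
  _andₑ_    : Test → Test → Test

data Program : Set where
  skip   : Program
  _≔_    : ℕ → Expr → Program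
  _[_]≔_ : ℕ → Expr → Expr → Program
  _⨟_    : Program → Program → Program
  ifₚ    : Test → Program → Program → Program
  while  : Test → Program → Program

⟦_⟧ : Expr → State → ℤ
⟦ lit z ⟧   s = z
⟦ ` x ⟧     s = var s x
⟦ a ‼ e ⟧   s = arr s a (⟦ e ⟧ s)
⟦ e ⊕ f ⟧   s = ⟦ e ⟧ s ℤ.+ ⟦ f ⟧ s
⟦ e ⊖ f ⟧   s = ⟦ e ⟧ s ℤ.- ⟦ f ⟧ s
⟦ e ⊗ f ⟧   s = ⟦ e ⟧ s ℤ.* ⟦ f ⟧ s

⟦_⟧ᵗ : Test → State → Bool
⟦ e ≤ₑ f ⟧ᵗ   s = ⌊ ⟦ e ⟧ s ℤ.≤? ⟦ f ⟧ s ⌋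
⟦ e =ₑ f ⟧ᵗ   s = ⌊ ⟦ e ⟧ s ℤ.≟ ⟦ f ⟧ s ⌋
⟦ notₑ b ⟧ᵗ   s = not (⟦ b ⟧ᵗ s)
⟦ b andₑ c ⟧ᵗ s = ⟦ b ⟧ᵗ s ∧ ⟦ c ⟧ᵗ s

-- Every literal, memory access, arithmetic operation, comparison and
-- connective costs one unit, whatever the size of the integers involved.

cost : Expr → ℕ
cost (lit _) = 1
cost (` _)   = 1
cost (_ ‼ e) = suc (cost e)
cost (e ⊕ f) = suc (cost e ℕ.+ cost f)
cost (e ⊖ f) = suc (cost e ℕ.+ cost f)
cost (e ⊗ f) = suc (cost e ℕ.+ cost f)

costᵗ : Test → ℕ
costᵗ (e ≤ₑ f)   = suc (cost e ℕ.+ cost f)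
costᵗ (e =ₑ f)   = suc (cost e ℕ.+ cost f)
costᵗ (notₑ b)   = suc (costᵗ b)
costᵗ (b andₑ c) = suc (costᵗ b ℕ.+ costᵗ c)

-- ⟨ p , s ⟩⇓⟨ s′ , t ⟩ : started in state s, the program p halts in state s′
-- after spending t units of time. The rules are deterministic.

infix 4 ⟨_,_⟩⇓⟨_,_⟩

data ⟨_,_⟩⇓⟨_,_⟩ : Program → State → State → ℕ → Set where
  ⇓skip   : ∀ {s} → ⟨ skip , s ⟩⇓⟨ s , 1 ⟩
  ⇓var    : ∀ {x e s} → ⟨ x ≔ e , s ⟩⇓⟨ setVar x (⟦ e ⟧ s) s , suc (cost e) ⟩
  ⇓arr    : ∀ {a i e s} →
            ⟨ a [ i ]≔ e , s ⟩⇓⟨ setArr a (⟦ i ⟧ s) (⟦ e ⟧ s) s ,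
                                suc (cost i ℕ.+ cost e) ⟩
  ⇓seq    : ∀ {p q s s′ s″ t t′} →
            ⟨ p , s ⟩⇓⟨ s′ , t ⟩ → ⟨ q , s′ ⟩⇓⟨ s″ , t′ ⟩ →
            ⟨ p ⨟ q , s ⟩⇓⟨ s″ , t ℕ.+ t′ ⟩
  ⇓true   : ∀ {b p q s s′ t} → ⟦ b ⟧ᵗ s ≡ true →
            ⟨ p , s ⟩⇓⟨ s′ , t ⟩ →
            ⟨ ifₚ b p q , s ⟩⇓⟨ s′ , suc (costᵗ b ℕ.+ t) ⟩
  ⇓false  : ∀ {b p q s s′ t} → ⟦ b ⟧ᵗ s ≡ false →
            ⟨ q , s ⟩⇓⟨ s′ , t ⟩ →
            ⟨ ifₚ b p q , s ⟩⇓⟨ s′ , suc (costᵗ b ℕ.+ t) ⟩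
  ⇓exit   : ∀ {b p s} → ⟦ b ⟧ᵗ s ≡ false →
            ⟨ while b p , s ⟩⇓⟨ s , suc (costᵗ b) ⟩
  ⇓repeat : ∀ {b p s s′ s″ t t′} → ⟦ b ⟧ᵗ s ≡ true →
            ⟨ p , s ⟩⇓⟨ s′ , t ⟩ → ⟨ while b p , s′ ⟩⇓⟨ s″ , t′ ⟩ →
            ⟨ while b p , s ⟩⇓⟨ s″ , suc (costᵗ b ℕ.+ (t ℕ.+ t′)) ⟩

-- Input convention: variable 0 holds n and array 0 holds the adjacency matrix
-- in row-major order (entry n * i + j for vertices i and j); all other memory
-- is 0.

adjacencyArray : ∀ {n} → Graph (Fin n) → ℤ → ℤ
adjacencyArray G -[1+ _ ] = + 0
adjacencyArray {n} G (+ k) with k ℕ.<? n ℕ.* n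
... | yes k<n² =
  if uncurry (adj G) (remQuot {n} n (fromℕ< k<n²)) then + 1 else + 0
... | no _     = + 0

initial : ∀ {n} → Graph (Fin n) → State
initial {n} G = mkState v a
  where
  v : ℕ → ℤ
  v zero    = + n
  v (suc _) = + 0
  a : ℕ → ℤ → ℤ
  a zero    = adjacencyArray G
  a (suc _) = λ _ → + 0

-- The result is read off variable 0.
_on_Computes_Within_ : ∀ {n} → Program → Graph (Fin n) → ℤ → ℕ → Set
p on G Computes z Within b =
  ∃₂ λ s t → ⟨ p , initial G ⟩⇓⟨ s , t ⟩ × var s 0 ≡ z × t ≤ b

------------------------------------------------------------------------
-- Asymptotics

infix 4 _∈O_

_∈O_ : (ℕ → ℕ) → (ℕ → ℕ) → Set
f ∈O g = ∃₂ λ c n₀ → ∀ n → n₀ ≤ n → f n ≤ c ℕ.* g n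

{-# OPTIONS --safe #-}
module Submission where

-- A cograph with at least two vertices has twins, and so does each of its
-- induced subgraphs with at least two vertices. Merging twins u and v into one
-- vertex, over and over, contracts the graph to a point, and every vertex of
-- an intermediate graph stands for a module of the input. For each module keep
-- the polynomial whose k-th coefficient counts the matchings leaving k of its
-- vertices uncovered. Between the modules of u and v either all edges are
-- present or none, so the polynomial of their union is Σ P(a) Q(b) X(a,b,k),
-- where X(a,b,k) counts the partial matchings between a and b free vertices
-- leaving k uncovered; X satisfies the recurrence
-- X(a+1,b,k) = X(a,b,k-1) + c b X(a,b-1,k), with c = 1 if u and v are adjacent
-- and c = 0 otherwise. Finding twins, tabulating X and forming the sum take
-- O(n³) steps each, and there are fewer than n merges.

open import Defs
open import Data.Bool using (Bool; true; false; not; _∧_; _∨_; if_then_else_; T; T?)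
open import Data.Bool.Properties using (∧-comm; ∧-assoc; ∧-zeroʳ; ∧-identityʳ; ∨-comm; T-≡)
open import Data.Empty using (⊥; ⊥-elim)
open import Data.Fin using (Fin; zero; suc; toℕ; fromℕ<; combine; remQuot; _≟_; _<?_)
  renaming (_<_ to _<ᶠ_)
open import Data.Fin.Properties
  using (all?; toℕ-combine; remQuot-combine; toℕ-injective; toℕ-fromℕ<; toℕ<n)
  renaming (<-irrefl to <ᶠ-irrefl; <-asym to <ᶠ-asym; <-trans to <ᶠ-trans; <⇒≢ to <ᶠ⇒≢)
open import Data.Integer as ℤ using (+_; +≤+; ∣_∣)
import Data.Integer.Properties as ℤ
open import Data.List
  using (List; []; _∷_; _∷ʳ_; _++_; map; filter; length; allFin; cartesianProduct; downFrom)
open import Data.List.Membership.Propositional using (_∈_)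
open import Data.List.Membership.Propositional.Properties
  using (∈-allFin; ∈-filter⁻; ∈-cartesianProduct⁻)
open import Data.List.Properties
  using (filter-++; length-++; length-map; length-tabulate; filter-≐; filter-none;
         filter-accept; filter-reject; ++-assoc)
open import Data.List.Relation.Unary.All as All using (All; []; _∷_)
import Data.List.Relation.Unary.All.Properties as All
open import Data.List.Relation.Unary.AllPairs using (AllPairs; []; _∷_)
open import Data.List.Relation.Unary.AllPairs.Properties using (tabulate⁺-<)
open import Data.List.Relation.Unary.Any using (here; there)
open import Data.List.Relation.Unary.Unique.Propositional using (Unique)
open import Data.List.Relation.Unary.Unique.Propositional.Properties using (allFin⁺)
open import Data.Nat as ℕ
  using (ℕ; zero; suc; pred; _+_; _*_; _^_; _≤_; _<_; z≤n; s≤s; s≤s⁻¹; _≡ᵇ_)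
open import Data.Nat.Properties hiding (_≟_; _<?_)
open import Data.Nat.Tactic.RingSolver using (solve-∀)
open import Data.Product using (∃; ∃₂; _×_; _,_; proj₁; proj₂; uncurry)
open import Data.Sum using (_⊎_; inj₁; inj₂)
open import Data.Unit using (⊤; tt)
open import Function using (_∘_; id)
open import Function.Bundles using (Equivalence; Inverse)
open import Relation.Binary.Definitions using (DecidableEquality; tri<; tri≈; tri>)
open import Relation.Binary.PropositionalEquality
open import Relation.Nullary using (¬_; Dec; yes; no)
open import Relation.Nullary.Decidable using (⌊_⌋; _×-dec_; dec-true; dec-false; isYes≗does)

-- Finite sums

-- No cotree is ever built. The input is only a matrix, in which twins are found by comparing rows;
-- that they exist follows by induction on the construction of the cograph. Their existence is
-- proved for an arbitrary vertex subset. The intermediate graphs are the subgraphs induced on the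
-- surviving representatives, so they need not be shown to be cographs and the matrix is never
-- rewritten. The obstacle is the product formula for two modules A and B. Splitting a matching into
-- its parts inside A, inside B and between them would call for bijections of edge sets. Instead
-- matchings are counted vertex by vertex, and both sides of the formula are shown to obey the same
-- recursion: a new vertex of A stays free, finds a partner in A, or takes a free vertex of B. The
-- last case differentiates the polynomial of B, and so does the recurrence for X. The time bound is
-- read off the syntax: the algorithm is written in a language whose loops all make n + 1 rounds and
-- whose types bound the nesting depth, here by 4.

𝟙 : Bool → ℕ
𝟙 true  = 1
𝟙 false = 0

∑ : {A : Set} → List A → (A → ℕ) → ℕ
∑ []       f = 0
∑ (x ∷ xs) f = f x + ∑ xs f


∑-cong-∈ : {A : Set} (xs : List A) {f g : A → ℕ} →
           (∀ {x} → x ∈ xs → f x ≡ g x) → ∑ xs f ≡ ∑ xs g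
∑-cong-∈ []       h = refl
∑-cong-∈ (x ∷ xs) h = cong₂ _+_ (h (here refl)) (∑-cong-∈ xs λ m → h (there m))

∑-cong : {A : Set} (xs : List A) {f g : A → ℕ} → (∀ x → f x ≡ g x) → ∑ xs f ≡ ∑ xs g
∑-cong xs h = ∑-cong-∈ xs λ {x} _ → h x

∑-zero : {A : Set} (xs : List A) → ∑ xs (λ _ → 0) ≡ 0
∑-zero []       = refl
∑-zero (x ∷ xs) = ∑-zero xs

∑-+ : {A : Set} (xs : List A) (f g : A → ℕ) →
      ∑ xs (λ x → f x + g x) ≡ ∑ xs f + ∑ xs g
∑-+ []       f g = refl
∑-+ (x ∷ xs) f g rewrite ∑-+ xs f g = lemma (f x) (g x) (∑ xs f) (∑ xs g)
  where
  lemma : ∀ a b c d → a + b + (c + d) ≡ a + c + (b + d)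
  lemma = solve-∀

∑-*ˡ : {A : Set} (c : ℕ) (xs : List A) (f : A → ℕ) →
       ∑ xs (λ x → c * f x) ≡ c * ∑ xs f
∑-*ˡ c []       f = sym (*-zeroʳ c)
∑-*ˡ c (x ∷ xs) f rewrite ∑-*ˡ c xs f = sym (*-distribˡ-+ c (f x) (∑ xs f))

∑-swap : {A B : Set} (xs : List A) (ys : List B) (f : A → B → ℕ) →
         ∑ xs (λ x → ∑ ys (f x)) ≡ ∑ ys (λ y → ∑ xs (λ x → f x y))
∑-swap []       ys f = sym (∑-zero ys)
∑-swap (x ∷ xs) ys f = begin
  ∑ ys (f x) + ∑ xs (λ x → ∑ ys (f x))          ≡⟨ cong (λ z → ∑ ys (f x) + z) (∑-swap xs ys f) ⟩
  ∑ ys (f x) + ∑ ys (λ y → ∑ xs (λ x → f x y))  ≡⟨ ∑-+ ys (f x) _ ⟨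
  ∑ ys (λ y → f x y + ∑ xs (λ x → f x y))       ∎
  where open ≡-Reasoning

∑-downFrom-suc : ∀ m (f : ℕ → ℕ) → f 0 ≡ 0 →
                 ∑ (downFrom (suc m)) f ≡ ∑ (downFrom m) (λ a → f (suc a))
∑-downFrom-suc zero    f f0 = trans (+-identityʳ (f 0)) f0
∑-downFrom-suc (suc m) f f0 = cong (λ z → f (suc m) + z) (∑-downFrom-suc m f f0)

-- Convolution of matching counts

-- Multiplication of a polynomial by its variable: one more vertex stays uncovered.
shift : (ℕ → ℕ) → ℕ → ℕ
shift f zero    = 0
shift f (suc k) = f k

shift-cong : ∀ {f g : ℕ → ℕ} → (∀ k → f k ≡ g k) → ∀ k → shift f k ≡ shift g k
shift-cong h zero    = refl
shift-cong h (suc k) = h k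

shift-+ : ∀ f g k → shift (λ k → f k + g k) k ≡ shift f k + shift g k
shift-+ f g zero    = refl
shift-+ f g (suc k) = refl

shift-* : ∀ c f k → shift (λ k → c * f k) k ≡ c * shift f k
shift-* c f zero    = sym (*-zeroʳ c)
shift-* c f (suc k) = refl

shift-∑ : {A : Set} (xs : List A) (f : A → ℕ → ℕ) → ∀ k →
          shift (λ k → ∑ xs (λ x → f x k)) k ≡ ∑ xs (λ x → shift (f x) k)
shift-∑ xs f zero    = sym (∑-zero xs)
shift-∑ xs f (suc k) = refl

derivative : (ℕ → ℕ) → ℕ → ℕ
derivative Q b = suc b * Q (suc b)

-- The number of partial matchings between a free vertices on one side and b
-- free vertices on the other that leave k of these a + b vertices uncovered,
-- when all pairs (c = true) or no pairs (c = false) are adjacent.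
crossing : Bool → ℕ → ℕ → ℕ → ℕ
crossing c zero    b k = 𝟙 (b ≡ᵇ k)
crossing c (suc a) b k =
  shift (crossing c a b) k + 𝟙 c * (b * crossing c a (pred b) k)

≡ᵇ-shift : ∀ b k → 𝟙 (suc b ≡ᵇ k) ≡ shift (λ k → 𝟙 (b ≡ᵇ k)) k
≡ᵇ-shift b zero    = refl
≡ᵇ-shift b (suc k) = refl

-- The definition peels vertices off the left side only; this is the mirrored recurrence, from which
-- symmetry follows. The junk value at `pred 0` is always multiplied by 0.
crossing-sucʳ : ∀ c a b k → crossing c a (suc b) k ≡
  shift (crossing c a b) k + 𝟙 c * (a * crossing c (pred a) b k)
crossing-sucʳ c zero b k rewrite *-zeroʳ (𝟙 c) | +-identityʳ (shift (crossing c 0 b) k) =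
  ≡ᵇ-shift b k
crossing-sucʳ c (suc a) b k = begin
  shift (X a (suc b)) k + e * (suc b * X a b k)
    ≡⟨ cong (_+ e * (suc b * X a b k)) (shift-cong (crossing-sucʳ c a b) k) ⟩
  shift (λ k → shift (X a b) k + e * (a * X (pred a) b k)) k + e * (suc b * X a b k)
    ≡⟨ cong (_+ e * (suc b * X a b k)) (push (shift (X a b)) a (X (pred a) b)) ⟩
  S + e * (a * shift (X (pred a) b) k) + e * (suc b * X a b k)
    ≡⟨ collect S e (a * shift (X (pred a) b) k) b (X a b k) ⟩
  S + e * (X a b k + (a * shift (X (pred a) b) k + b * X a b k))
    ≡⟨ cong (λ z → S + e * (X a b k + z)) (exchange a b k) ⟩
  S + e * (X a b k + (b * shift (X a (pred b)) k + a * X a b k))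
    ≡⟨ collect S e (b * shift (X a (pred b)) k) a (X a b k) ⟨
  S + e * (b * shift (X a (pred b)) k) + e * (suc a * X a b k)
    ≡⟨ cong (_+ e * (suc a * X a b k)) (push (shift (X a b)) b (X a (pred b))) ⟨
  shift (X (suc a) b) k + e * (suc a * X a b k) ∎
  where
  open ≡-Reasoning
  X = crossing c
  e = 𝟙 c
  S = shift (shift (X a b)) k
  push : ∀ f d g → shift (λ k → f k + e * (d * g k)) k ≡ shift f k + e * (d * shift g k)
  push f d g = trans (shift-+ f _ k) (cong (λ z → shift f k + z)
    (trans (shift-* e _ k) (cong (e *_) (shift-* d g k))))
  collect : ∀ s e u b x → s + e * u + e * (suc b * x) ≡ s + e * (x + (u + b * x))
  collect = solve-∀
  -- Both sides expand a b (X a b) by one of the two recurrences.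
  exchange : ∀ a b k → a * shift (X (pred a) b) k + b * X a b k ≡
                       b * shift (X a (pred b)) k + a * X a b k
  exchange zero    zero    k = refl
  exchange zero    (suc b) k =
    trans (cong (suc b *_) (≡ᵇ-shift b k)) (sym (+-identityʳ _))
  exchange (suc a) zero    k rewrite *-zeroʳ (𝟙 c) | +-identityʳ (shift (X a 0) k) =
    +-identityʳ _
  exchange (suc a) (suc b) k = begin
    suc a * p + suc b * X (suc a) (suc b) k
      -- Here `suc a` is the `a` of the enclosing clause, so this is the induction hypothesis.
      ≡⟨ cong (λ z → suc a * p + suc b * z) (crossing-sucʳ c (suc a) b k) ⟩
    suc a * p + suc b * (q + e * (suc a * X a b k))
      ≡⟨ balance a b p q e (X a b k) ⟩
    suc b * q + suc a * X (suc a) (suc b) k ∎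
    where
    p = shift (X a (suc b)) k
    q = shift (X (suc a) b) k
    balance : ∀ a b p q e x → suc a * p + suc b * (q + e * (suc a * x)) ≡
                              suc b * q + suc a * (p + e * (suc b * x))
    balance = solve-∀

-- The left and the right recurrence are mirror images, so flipping the smaller entries by induction
-- turns one into the other.
crossing-sym : ∀ c a b k → crossing c a b k ≡ crossing c b a k
crossing-sym c zero zero    k = refl
crossing-sym c zero (suc b) k = begin
  𝟙 (suc b ≡ᵇ k)                                            ≡⟨ ≡ᵇ-shift b k ⟩
  shift (crossing c 0 b) k                                  ≡⟨ shift-cong (crossing-sym c 0 b) k ⟩
  shift (crossing c b 0) k                                  ≡⟨ +-identityʳ _ ⟨
  shift (crossing c b 0) k + 0                              ≡⟨ cong (λ z → shift (crossing c b 0) k + z) (*-zeroʳ (𝟙 c)) ⟨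
  shift (crossing c b 0) k + 𝟙 c * 0                        ∎
  where open ≡-Reasoning
crossing-sym c (suc a) b k = begin
  shift (crossing c a b) k + 𝟙 c * (b * crossing c a (pred b) k)
    ≡⟨ cong₂ (λ x y → x + 𝟙 c * (b * y)) (shift-cong (crossing-sym c a b) k) (crossing-sym c a (pred b) k) ⟩
  shift (crossing c b a) k + 𝟙 c * (b * crossing c (pred b) a k)
    ≡⟨ crossing-sucʳ c b a k ⟨
  crossing c b (suc a) k ∎
  where open ≡-Reasoning

module _ (c : Bool) where

  open ≡-Reasoning

  -- `downFrom` puts the largest index first, so that one more iteration of an accumulating loop
  -- adds one term at the head. The double sum is split into rows just as the program evaluates it.
  crossingRow : ℕ → (ℕ → ℕ) → ℕ → ℕ → ℕ
  crossingRow m Q a k = ∑ (downFrom m) λ b → Q b * crossing c a b k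

  crossingProduct : ℕ → (ℕ → ℕ) → (ℕ → ℕ) → ℕ → ℕ
  crossingProduct m P Q k = ∑ (downFrom m) λ a → P a * crossingRow m Q a k

  crossingProduct-cong : ∀ m {P P′ Q Q′ : ℕ → ℕ} → (∀ a → P a ≡ P′ a) → (∀ b → Q b ≡ Q′ b) →
    ∀ k → crossingProduct m P Q k ≡ crossingProduct m P′ Q′ k
  crossingProduct-cong m p q k = ∑-cong (downFrom m) λ a → cong₂ _*_ (p a)
    (∑-cong (downFrom m) λ b → cong (_* crossing c a b k) (q b))

  crossingProduct-sym : ∀ m P Q k → crossingProduct m P Q k ≡ crossingProduct m Q P k
  crossingProduct-sym m P Q k = begin
    ∑ N (λ a → P a * ∑ N (λ b → Q b * X a b k))    ≡⟨ ∑-cong N (λ a → ∑-*ˡ (P a) N _) ⟨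
    ∑ N (λ a → ∑ N (λ b → P a * (Q b * X a b k)))  ≡⟨ ∑-swap N N _ ⟩
    ∑ N (λ b → ∑ N (λ a → P a * (Q b * X a b k)))  ≡⟨ (∑-cong N λ b → ∑-cong N λ a → exchange a b) ⟩
    ∑ N (λ b → ∑ N (λ a → Q b * (P a * X b a k)))  ≡⟨ ∑-cong N (λ b → ∑-*ˡ (Q b) N _) ⟩
    ∑ N (λ b → Q b * ∑ N (λ a → P a * X b a k))    ∎
    where
    N = downFrom m
    X = crossing c
    swap : ∀ p q x → p * (q * x) ≡ q * (p * x)
    swap = solve-∀
    exchange : ∀ a b → P a * (Q b * X a b k) ≡ Q b * (P a * X b a k)
    exchange a b = trans (swap (P a) (Q b) _) (cong (λ z → Q b * (P a * z)) (crossing-sym c a b k))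

  crossingProduct-+ˡ : ∀ m P P′ Q k → crossingProduct m (λ a → P a + P′ a) Q k ≡
                       crossingProduct m P Q k + crossingProduct m P′ Q k
  crossingProduct-+ˡ m P P′ Q k =
    trans (∑-cong (downFrom m) λ a → *-distribʳ-+ (crossingRow m Q a k) (P a) (P′ a))
          (∑-+ (downFrom m) _ _)

  crossingProduct-∑ˡ : ∀ m {A : Set} (xs : List A) (w : A → ℕ) (P : A → ℕ → ℕ) Q k →
    crossingProduct m (λ a → ∑ xs (λ x → w x * P x a)) Q k ≡
    ∑ xs (λ x → w x * crossingProduct m (P x) Q k)
  crossingProduct-∑ˡ m xs w P Q k = begin
    ∑ N (λ a → ∑ xs (λ x → w x * P x a) * R a)
      ≡⟨ (∑-cong N λ a → trans (*-comm _ (R a)) (sym (∑-*ˡ (R a) xs _))) ⟩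
    ∑ N (λ a → ∑ xs (λ x → R a * (w x * P x a)))
      ≡⟨ ∑-swap N xs _ ⟩
    ∑ xs (λ x → ∑ N (λ a → R a * (w x * P x a)))
      ≡⟨ (∑-cong xs λ x → trans (∑-cong N λ a → rotate (R a) (w x) (P x a)) (∑-*ˡ (w x) N _)) ⟩
    ∑ xs (λ x → w x * ∑ N (λ a → P x a * R a))    ∎
    where
    N = downFrom m
    R = λ a → crossingRow m Q a k
    rotate : ∀ r w p → r * (w * p) ≡ w * (p * r)
    rotate = solve-∀

  crossingProduct-∑ʳ : ∀ m {A : Set} (xs : List A) (w : A → ℕ) P (Q : A → ℕ → ℕ) k →
    crossingProduct m P (λ b → ∑ xs (λ x → w x * Q x b)) k ≡
    ∑ xs (λ x → w x * crossingProduct m P (Q x) k)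
  crossingProduct-∑ʳ m xs w P Q k =
    trans (crossingProduct-sym m P (λ b → ∑ xs (λ x → w x * Q x b)) k)
      (trans (crossingProduct-∑ˡ m xs w Q P k)
      (∑-cong xs λ x → cong (w x *_) (crossingProduct-sym m (Q x) P k)))

  -- In the recurrence for X(a+1,b,k) the factor b moves from X(a,b-1,k) onto Q(b), and reindexing b
  -- makes it a derivative.
  crossingRow-suc : ∀ m Q a k → Q (suc m) ≡ 0 → crossingRow (suc m) Q (suc a) k ≡
    shift (crossingRow (suc m) Q a) k + 𝟙 c * crossingRow (suc m) (derivative Q) a k
  crossingRow-suc m Q a k Qm = begin
    ∑ N (λ b → Q b * (shift (X a b) k + 𝟙 c * (b * X a (pred b) k)))
      ≡⟨ ∑-cong N (λ b → distribute (Q b) (shift (X a b) k) (𝟙 c) b (X a (pred b) k)) ⟩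
    ∑ N (λ b → Q b * shift (X a b) k + 𝟙 c * (b * (Q b * X a (pred b) k)))
      ≡⟨ ∑-+ N (λ b → Q b * shift (X a b) k) _ ⟩
    ∑ N (λ b → Q b * shift (X a b) k) + ∑ N (λ b → 𝟙 c * (b * (Q b * X a (pred b) k)))
      ≡⟨ cong₂ _+_ left right ⟩
    shift (crossingRow (suc m) Q a) k + 𝟙 c * crossingRow (suc m) (derivative Q) a k ∎
    where
    N = downFrom (suc m)
    X = crossing c
    distribute : ∀ q s e b x → q * (s + e * (b * x)) ≡ q * s + e * (b * (q * x))
    distribute = solve-∀
    left : ∑ N (λ b → Q b * shift (X a b) k) ≡ shift (crossingRow (suc m) Q a) k
    left = trans (∑-cong N λ b → sym (shift-* (Q b) (X a b) k)) (sym (shift-∑ N _ k))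
    -- Reindexing shortens the range to b < m; the missing term b = m contains Q(m+1) = 0.
    top : derivative Q m * X a m k ≡ 0
    top = trans (cong (λ z → suc m * z * X a m k) Qm) (cong (_* X a m k) (*-zeroʳ m))
    right : ∑ N (λ b → 𝟙 c * (b * (Q b * X a (pred b) k))) ≡
            𝟙 c * crossingRow (suc m) (derivative Q) a k
    right = trans (∑-*ˡ (𝟙 c) N _) (cong (𝟙 c *_) (begin
      ∑ N (λ b → b * (Q b * X a (pred b) k))                        ≡⟨ ∑-downFrom-suc m _ refl ⟩
      ∑ (downFrom m) (λ b → suc b * (Q (suc b) * X a b k))          ≡⟨ ∑-cong (downFrom m) (λ b → *-assoc (suc b) (Q (suc b)) _) ⟨
      crossingRow m (derivative Q) a k                              ≡⟨ cong (_+ crossingRow m (derivative Q) a k) top ⟨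
      crossingRow (suc m) (derivative Q) a k                        ∎))

  -- An additional free vertex on the left either stays uncovered or takes one of the free vertices
  -- on the right. The vanishing top coefficients ensure that truncating the sums loses nothing.
  crossingProduct-shiftˡ : ∀ m P Q k → P m ≡ 0 → Q (suc m) ≡ 0 →
    crossingProduct (suc m) (shift P) Q k ≡
    shift (crossingProduct (suc m) P Q) k + 𝟙 c * crossingProduct (suc m) P (derivative Q) k
  crossingProduct-shiftˡ m P Q k Pm Qm = begin
    ∑ N (λ a → shift P a * R Q a k)
      ≡⟨ ∑-downFrom-suc m _ refl ⟩
    ∑ (downFrom m) (λ a → P a * R Q (suc a) k)
      ≡⟨ cong (λ z → z * R Q (suc m) k + ∑ (downFrom m) (λ a → P a * R Q (suc a) k)) Pm ⟨
    ∑ N (λ a → P a * R Q (suc a) k)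
      ≡⟨ (∑-cong N λ a → trans (cong (P a *_) (crossingRow-suc m Q a k Qm))
                               (distribute (P a) (shift (R Q a) k) (𝟙 c) _)) ⟩
    ∑ N (λ a → P a * shift (R Q a) k + 𝟙 c * (P a * R Q′ a k))
      ≡⟨ ∑-+ N (λ a → P a * shift (R Q a) k) _ ⟩
    ∑ N (λ a → P a * shift (R Q a) k) + ∑ N (λ a → 𝟙 c * (P a * R Q′ a k))
      ≡⟨ cong₂ _+_ (trans (∑-cong N λ a → sym (shift-* (P a) (R Q a) k)) (sym (shift-∑ N _ k))) (∑-*ˡ (𝟙 c) N _) ⟩
    shift (crossingProduct (suc m) P Q) k + 𝟙 c * crossingProduct (suc m) P Q′ k ∎
    where
    N  = downFrom (suc m)
    R  = crossingRow (suc m)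
    Q′ = derivative Q
    distribute : ∀ p s e r → p * (s + e * r) ≡ p * s + e * (p * r)
    distribute = solve-∀

-- Matchings of an induced subgraph

module Matchings {V : Set} (_≟_ : DecidableEquality V) (G : Graph V) where

  open ≡-Reasoning

  infixl 7 _∖_
  infixl 6 _∪_

  _∖_ : (V → Bool) → V → V → Bool
  (S ∖ y) z = S z ∧ not ⌊ z ≟ y ⌋

  _∪_ : (V → Bool) → (V → Bool) → V → Bool
  (A ∪ B) z = A z ∨ B z

  ∖-self : ∀ S y → (S ∖ y) y ≡ false
  ∖-self S y with y ≟ y
  ... | yes _   = ∧-zeroʳ (S y)
  ... | no y≢y = ⊥-elim (y≢y refl)

  ∖-other : ∀ S {y z} → z ≢ y → (S ∖ y) z ≡ S z
  ∖-other S {y} {z} z≢y with z ≟ y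
  ... | yes z≡y = ⊥-elim (z≢y z≡y)
  ... | no _    = ∧-identityʳ (S z)

  ∖-⊆ : ∀ S y {z} → (S ∖ y) z ≡ true → S z ≡ true
  ∖-⊆ S y {z} h with S z
  ... | true = refl

  ∖-swap : ∀ S x y z → (S ∖ x ∖ y) z ≡ (S ∖ y ∖ x) z
  ∖-swap S x y z = trans (∧-assoc (S z) _ _)
    (trans (cong (S z ∧_) (∧-comm (not ⌊ z ≟ x ⌋) _)) (sym (∧-assoc (S z) _ _)))

  ∖-cong : ∀ S S′ y {z} → S z ≡ S′ z → (S ∖ y) z ≡ (S′ ∖ y) z
  ∖-cong S S′ y {z} = cong (_∧ not ⌊ z ≟ y ⌋)

  -- The number of matchings of the subgraph induced by the members of S among
  -- xs that leave exactly k vertices uncovered.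
  matchings : List V → (V → Bool) → ℕ → ℕ
  matchings []       S zero    = 1
  matchings []       S (suc k) = 0
  matchings (x ∷ xs) S k =
    if S x
    then shift (matchings xs S) k +
         ∑ xs (λ y → 𝟙 (S y ∧ adj G x y) * matchings xs (S ∖ y) k)
    else matchings xs S k

  partners : V → List V → (V → Bool) → ℕ → ℕ
  partners x xs S k = ∑ xs (λ y → 𝟙 (S y ∧ adj G x y) * matchings xs (S ∖ y) k)

  matchings-in : ∀ x xs S k → S x ≡ true →
    matchings (x ∷ xs) S k ≡ shift (matchings xs S) k + partners x xs S k
  matchings-in x xs S k Sx rewrite Sx = refl

  matchings-out : ∀ x xs S k → S x ≡ false → matchings (x ∷ xs) S k ≡ matchings xs S k
  matchings-out x xs S k Sx rewrite Sx = refl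

  matchings-cong : ∀ xs {S S′} → (∀ {x} → x ∈ xs → S x ≡ S′ x) →
                   ∀ k → matchings xs S k ≡ matchings xs S′ k
  matchings-cong []       h zero    = refl
  matchings-cong []       h (suc k) = refl
  matchings-cong (x ∷ xs) {S} {S′} h k rewrite h (here refl) with S′ x
  ... | false = matchings-cong xs (λ m → h (there m)) k
  ... | true  = cong₂ _+_ (shift-cong (matchings-cong xs λ m → h (there m)) k)
    (∑-cong-∈ xs λ {y} y∈ → cong₂ (λ b z → 𝟙 (b ∧ adj G x y) * z) (h (there y∈))
      (matchings-cong xs (λ m → ∖-cong S S′ y (h (there m))) k))

  matchings-zero : ∀ xs S k → length xs < k → matchings xs S k ≡ 0
  matchings-zero []       S (suc k) _ = refl
  matchings-zero (x ∷ xs) S (suc k) (s≤s l) with S x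
  ... | false = matchings-zero xs S (suc k) (m≤n⇒m≤1+n l)
  ... | true  = cong₂ _+_ (matchings-zero xs S k l) (trans (∑-cong xs λ y →
      trans (cong (𝟙 (S y ∧ adj G x y) *_) (matchings-zero xs (S ∖ y) (suc k) (m≤n⇒m≤1+n l)))
            (*-zeroʳ (𝟙 (S y ∧ adj G x y))))
    (∑-zero xs))

  𝟙-∧ : ∀ a b → 𝟙 (a ∧ b) ≡ 𝟙 a * 𝟙 b
  𝟙-∧ true  b = sym (+-identityʳ (𝟙 b))
  𝟙-∧ false b = refl

  ≟-sym : ∀ y z → ⌊ y ≟ z ⌋ ≡ ⌊ z ≟ y ⌋
  ≟-sym y z with y ≟ z | z ≟ y
  ... | yes _ | yes _ = refl
  ... | no _  | no _  = refl
  ... | yes p | no q  = ⊥-elim (q (sym p))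
  ... | no p  | yes q = ⊥-elim (p (sym q))

  -- Both sides count matchings with a marked uncovered vertex.
  matchings-derivative : ∀ {xs} → Unique xs → ∀ B b →
    ∑ xs (λ y → 𝟙 (B y) * matchings xs (B ∖ y) b) ≡ derivative (matchings xs B) b
  matchings-derivative []             B b = sym (*-zeroʳ (suc b))
  matchings-derivative {x ∷ xs} (x≢xs ∷ u) B b = step (B x) refl
    where
    N = matchings xs B
    collect : ∀ b m p → m + (b * m + suc b * p) ≡ suc b * (m + p)
    collect = solve-∀
    here-term : 1 * matchings (x ∷ xs) (B ∖ x) b ≡ N b
    here-term = trans (*-identityˡ _) (trans (matchings-out x xs (B ∖ x) b (∖-self B x))
      (matchings-cong xs (λ y∈ → ∖-other B λ y≡x → All.lookup x≢xs y∈ (sym y≡x)) b))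
    split : B x ≡ true → ∀ {y} → y ∈ xs → 𝟙 (B y) * matchings (x ∷ xs) (B ∖ y) b ≡
      𝟙 (B y) * shift (matchings xs (B ∖ y)) b + 𝟙 (B y) * partners x xs (B ∖ y) b
    split Bx {y} y∈ = trans
      (cong (𝟙 (B y) *_) (matchings-in x xs (B ∖ y) b (trans (∖-other B (All.lookup x≢xs y∈)) Bx)))
      (*-distribˡ-+ (𝟙 (B y)) _ _)
    uncovered : ∀ b → ∑ xs (λ y → 𝟙 (B y) * shift (matchings xs (B ∖ y)) b) ≡ b * N b
    uncovered zero    = trans (∑-cong xs λ y → *-zeroʳ (𝟙 (B y))) (∑-zero xs)
    uncovered (suc b) = matchings-derivative u B b
    exchange : ∀ y z → 𝟙 (B y) * (𝟙 ((B ∖ y) z ∧ adj G x z) * matchings xs (B ∖ y ∖ z) b) ≡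
                       𝟙 (B z ∧ adj G x z) * (𝟙 ((B ∖ z) y) * matchings xs (B ∖ z ∖ y) b)
    exchange y z
      rewrite matchings-cong xs {B ∖ y ∖ z} {B ∖ z ∖ y} (λ {v} _ → ∖-swap B y z v) b
            | 𝟙-∧ ((B ∖ y) z) (adj G x z) | 𝟙-∧ (B z) (adj G x z)
            | 𝟙-∧ (B z) (not ⌊ z ≟ y ⌋) | 𝟙-∧ (B y) (not ⌊ y ≟ z ⌋)
            | ≟-sym y z = rearrange (𝟙 (B y)) (𝟙 (B z)) (𝟙 (not ⌊ z ≟ y ⌋)) (𝟙 (adj G x z)) _
      where
      rearrange : ∀ p q r s t → p * (q * r * s * t) ≡ q * s * (p * r * t)
      rearrange = solve-∀
    -- The marked vertex y and the partner z of x are distinct members of B and can be chosen in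
    -- either order; with z chosen first, the induction hypothesis for `B ∖ z` sums over y.
    covered : ∑ xs (λ y → 𝟙 (B y) * partners x xs (B ∖ y) b) ≡ suc b * partners x xs B (suc b)
    covered = begin
      ∑ xs (λ y → 𝟙 (B y) * partners x xs (B ∖ y) b)
        ≡⟨ ∑-cong xs (λ y → ∑-*ˡ (𝟙 (B y)) xs _) ⟨
      ∑ xs (λ y → ∑ xs (λ z → 𝟙 (B y) * (𝟙 ((B ∖ y) z ∧ adj G x z) * matchings xs (B ∖ y ∖ z) b)))
        ≡⟨ (∑-cong xs λ y → ∑-cong xs λ z → exchange y z) ⟩
      ∑ xs (λ y → ∑ xs (λ z → 𝟙 (B z ∧ adj G x z) * (𝟙 ((B ∖ z) y) * matchings xs (B ∖ z ∖ y) b)))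
        ≡⟨ ∑-swap xs xs _ ⟩
      ∑ xs (λ z → ∑ xs (λ y → 𝟙 (B z ∧ adj G x z) * (𝟙 ((B ∖ z) y) * matchings xs (B ∖ z ∖ y) b)))
        ≡⟨ (∑-cong xs λ z → trans (∑-*ˡ (𝟙 (B z ∧ adj G x z)) xs _)
             (cong (𝟙 (B z ∧ adj G x z) *_) (matchings-derivative u (B ∖ z) b))) ⟩
      ∑ xs (λ z → 𝟙 (B z ∧ adj G x z) * (suc b * matchings xs (B ∖ z) (suc b)))
        ≡⟨ (∑-cong xs λ z → rotate (𝟙 (B z ∧ adj G x z)) (suc b) _) ⟩
      ∑ xs (λ z → suc b * (𝟙 (B z ∧ adj G x z) * matchings xs (B ∖ z) (suc b)))
        ≡⟨ ∑-*ˡ (suc b) xs _ ⟩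
      suc b * partners x xs B (suc b) ∎
      where
      rotate : ∀ p q r → p * (q * r) ≡ q * (p * r)
      rotate = solve-∀
    there-terms : B x ≡ true → ∑ xs (λ y → 𝟙 (B y) * matchings (x ∷ xs) (B ∖ y) b) ≡
                  b * N b + suc b * partners x xs B (suc b)
    there-terms Bx = trans (∑-cong-∈ xs (split Bx))
      (trans (∑-+ xs (λ y → 𝟙 (B y) * shift (matchings xs (B ∖ y)) b) _)
             (cong₂ _+_ (uncovered b) covered))
    step : ∀ t → B x ≡ t → ∑ (x ∷ xs) (λ y → 𝟙 (B y) * matchings (x ∷ xs) (B ∖ y) b) ≡
                           derivative (matchings (x ∷ xs) B) b
    step false Bx = begin
      𝟙 (B x) * matchings (x ∷ xs) (B ∖ x) b + ∑ xs (λ y → 𝟙 (B y) * matchings (x ∷ xs) (B ∖ y) b)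
        ≡⟨ cong₂ _+_ (cong (λ t → 𝟙 t * matchings (x ∷ xs) (B ∖ x) b) Bx)
             (∑-cong-∈ xs λ {y} y∈ → cong (𝟙 (B y) *_)
               (matchings-out x xs (B ∖ y) b (trans (∖-other B (All.lookup x≢xs y∈)) Bx))) ⟩
      ∑ xs (λ y → 𝟙 (B y) * matchings xs (B ∖ y) b)
        ≡⟨ matchings-derivative u B b ⟩
      derivative N b
        ≡⟨ cong (suc b *_) (matchings-out x xs B (suc b) Bx) ⟨
      derivative (matchings (x ∷ xs) B) b ∎
    step true Bx = begin
      𝟙 (B x) * matchings (x ∷ xs) (B ∖ x) b + ∑ xs (λ y → 𝟙 (B y) * matchings (x ∷ xs) (B ∖ y) b)
        ≡⟨ cong₂ _+_ (trans (cong (λ t → 𝟙 t * matchings (x ∷ xs) (B ∖ x) b) Bx) here-term)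
             (there-terms Bx) ⟩
      N b + (b * N b + suc b * partners x xs B (suc b))
        ≡⟨ collect b (N b) (partners x xs B (suc b)) ⟩
      suc b * (N b + partners x xs B (suc b))
        ≡⟨ cong (suc b *_) (matchings-in x xs B (suc b) Bx) ⟨
      derivative (matchings (x ∷ xs) B) b ∎

  -- The product formula for two sets with all or no edges between them

  record Separated (c : Bool) (A B : V → Bool) : Set where
    field
      disjoint : ∀ {x} → A x ≡ true → B x ≡ true → ⊥
      cross    : ∀ {x y} → A x ≡ true → B y ≡ true → adj G x y ≡ c

  open Separated

  Separated-sym : ∀ {c A B} → Separated c A B → Separated c B A
  Separated-sym s = record
    { disjoint = λ b a → disjoint s a b
    ; cross    = λ {x} {y} b a → trans (symm G x y) (cross s a b) }

  Separated-∖ˡ : ∀ {c A B} y → Separated c A B → Separated c (A ∖ y) B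
  Separated-∖ˡ {A = A} y s = record
    { disjoint = λ a b → disjoint s (∖-⊆ A y a) b
    ; cross    = λ a b → cross s (∖-⊆ A y a) b }

  ∪-comm : ∀ A B x → (A ∪ B) x ≡ (B ∪ A) x
  ∪-comm A B x = ∨-comm (A x) (B x)

  ∪-∖ˡ : ∀ A B y → B y ≡ false → ∀ x → ((A ∪ B) ∖ y) x ≡ ((A ∖ y) ∪ B) x
  ∪-∖ˡ A B y By x with x ≟ y
  ... | yes refl rewrite By = trans (∧-zeroʳ (A x ∨ false)) (sym (cong (_∨ false) (∧-zeroʳ (A x))))
  ... | no _     = trans (∧-identityʳ (A x ∨ B x)) (cong (_∨ B x) (sym (∧-identityʳ (A x))))

  ∑-empty : ∀ m S (g : ℕ → ℕ) → ∑ (downFrom (suc m)) (λ a → matchings [] S a * g a) ≡ g 0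
  ∑-empty zero    S g = trans (+-identityʳ _) (+-identityʳ (g 0))
  ∑-empty (suc m) S g = ∑-empty m S g

  module _ (c : Bool) (m : ℕ) where

    -- For lists of length at most m all coefficients beyond m vanish, so the truncation at `suc m`
    -- is harmless.
    Product : List V → (V → Bool) → (V → Bool) → Set
    Product xs A B = ∀ k → matchings xs (A ∪ B) k ≡
      crossingProduct c (suc m) (matchings xs A) (matchings xs B) k

    Product-sym : ∀ {xs A B} → Product xs A B → Product xs B A
    Product-sym {xs} {A} {B} p k = begin
      matchings xs (B ∪ A) k   ≡⟨ matchings-cong xs (λ {x} _ → ∪-comm B A x) k ⟩
      matchings xs (A ∪ B) k   ≡⟨ p k ⟩
      crossingProduct c (suc m) (matchings xs A) (matchings xs B) k
        ≡⟨ crossingProduct-sym c (suc m) (matchings xs A) (matchings xs B) k ⟩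
      crossingProduct c (suc m) (matchings xs B) (matchings xs A) k ∎

    -- The vertex x of A is free, matched inside A, or matched into B. The first and third cases
    -- together are `crossingProduct-shiftˡ`, the second is linearity in the left factor. The
    -- induction hypothesis is an argument, ranging over all pairs of sets, because matching x
    -- shrinks one of them and because the step is reused with A and B exchanged.
    Product-step : ∀ {x xs} → Unique (x ∷ xs) → length xs < m →
      (∀ {A B} → Separated c A B → Product xs A B) →
      ∀ {A B} → Separated c A B → A x ≡ true → Product (x ∷ xs) A B
    Product-step {x} {xs} (_ ∷ u) l ih {A} {B} s Ax k = begin
      matchings (x ∷ xs) (A ∪ B) k
        ≡⟨ matchings-in x xs (A ∪ B) k (cong (_∨ B x) Ax) ⟩
      shift (matchings xs (A ∪ B)) k + partners x xs (A ∪ B) k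
        ≡⟨ cong₂ _+_ (shift-cong (ih s) k) split-partners ⟩
      shift (P ⊛ Q) k + (partnersA + 𝟙 c * (P ⊛ derivative Q) k)
        ≡⟨ regroup (shift (P ⊛ Q) k) partnersA _ ⟩
      shift (P ⊛ Q) k + 𝟙 c * (P ⊛ derivative Q) k + partnersA
        ≡⟨ cong₂ _+_ (crossingProduct-shiftˡ c m P Q k (matchings-zero xs A m l)
             (matchings-zero xs B (suc m) (m≤n⇒m≤1+n l)))
             (crossingProduct-∑ˡ c (suc m) xs wA _ Q k) ⟨
      (shift P ⊛ Q) k + (partners x xs A ⊛ Q) k
        ≡⟨ crossingProduct-+ˡ c (suc m) (shift P) _ Q k ⟨
      ((λ a → shift P a + partners x xs A a) ⊛ Q) k
        ≡⟨ crossingProduct-cong c (suc m) (λ a → matchings-in x xs A a Ax)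
             (λ b → matchings-out x xs B b Bx) k ⟨
      (matchings (x ∷ xs) A ⊛ matchings (x ∷ xs) B) k ∎
      where
      infix 8 _⊛_
      _⊛_ = crossingProduct c (suc m)
      P = matchings xs A
      Q = matchings xs B
      wA = λ y → 𝟙 (A y ∧ adj G x y)
      partnersA = ∑ xs λ y → wA y * (matchings xs (A ∖ y) ⊛ Q) k
      regroup : ∀ p q r → p + (q + r) ≡ p + r + q
      regroup = solve-∀
      only : ∀ {y} → A y ≡ true → B y ≡ false
      only {y} Ay with B y in By
      ... | false = refl
      ... | true  = ⊥-elim (disjoint s Ay By)
      Bx : B x ≡ false
      Bx = only Ax
      -- A partner y in A leaves B intact; a partner y in B is available exactly when c holds, and
      -- leaves A intact.
      split : ∀ y → 𝟙 ((A ∪ B) y ∧ adj G x y) * matchings xs ((A ∪ B) ∖ y) k ≡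
        wA y * (matchings xs (A ∖ y) ⊛ Q) k + 𝟙 c * (𝟙 (B y) * (P ⊛ matchings xs (B ∖ y)) k)
      split y with A y in Ay | B y in By
      ... | true | true   = ⊥-elim (disjoint s Ay By)
      ... | false | false = sym (*-zeroʳ (𝟙 c))
      ... | true | false  = trans
        (cong (𝟙 (adj G x y) *_) (trans (matchings-cong xs (λ {z} _ → ∪-∖ˡ A B y By z) k)
          (ih (Separated-∖ˡ y s) k)))
        (sym (trans (cong (λ z → 𝟙 (adj G x y) * (matchings xs (A ∖ y) ⊛ Q) k + z) (*-zeroʳ (𝟙 c))) (+-identityʳ _)))
      ... | false | true  rewrite cross s {x} {y} Ax By = cong (𝟙 c *_) (trans
        (trans (matchings-cong xs (λ {z} _ → trans (∖-cong (A ∪ B) (B ∪ A) y (∪-comm A B z))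
          (trans (∪-∖ˡ B A y Ay z) (∪-comm (B ∖ y) A z))) k)
          (Product-sym {xs} {B ∖ y} {A} (ih (Separated-∖ˡ y (Separated-sym s))) k))
        (sym (+-identityʳ _)))
      split-partners : partners x xs (A ∪ B) k ≡ partnersA + 𝟙 c * (P ⊛ derivative Q) k
      split-partners = begin
        partners x xs (A ∪ B) k
          ≡⟨ trans (∑-cong xs split) (∑-+ xs (λ y → wA y * (matchings xs (A ∖ y) ⊛ Q) k) _) ⟩
        partnersA + ∑ xs (λ y → 𝟙 c * (𝟙 (B y) * (P ⊛ matchings xs (B ∖ y)) k))
          ≡⟨ cong (λ z → partnersA + z) (∑-*ˡ (𝟙 c) xs _) ⟩
        partnersA + 𝟙 c * ∑ xs (λ y → 𝟙 (B y) * (P ⊛ matchings xs (B ∖ y)) k)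
          ≡⟨ cong (λ z → partnersA + 𝟙 c * z) (crossingProduct-∑ʳ c (suc m) xs (λ y → 𝟙 (B y)) P _ k) ⟨
        partnersA + 𝟙 c * (P ⊛ (λ b → ∑ xs (λ y → 𝟙 (B y) * matchings xs (B ∖ y) b))) k
          ≡⟨ cong (λ z → partnersA + 𝟙 c * z)
               (crossingProduct-cong c (suc m) {P} (λ _ → refl) (matchings-derivative u B) k) ⟩
        partnersA + 𝟙 c * (P ⊛ derivative Q) k ∎

    -- Induction on the common vertex list. A head in B is handled by symmetry of the crossing
    -- product, and a head in neither set is skipped by all three counts.
    matchings-∪ : ∀ {xs} → Unique xs → length xs ≤ m →
                  ∀ {A B} → Separated c A B → Product xs A B
    matchings-∪ {[]} _ _ {A} {B} s k = begin
      matchings [] (A ∪ B) k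
        ≡⟨ empty k ⟩
      𝟙 (0 ≡ᵇ k)
        ≡⟨ ∑-empty m B (λ b → crossing c 0 b k) ⟨
      crossingRow c (suc m) (matchings [] B) 0 k
        ≡⟨ ∑-empty m A (λ a → crossingRow c (suc m) (matchings [] B) a k) ⟨
      crossingProduct c (suc m) (matchings [] A) (matchings [] B) k ∎
      where
      empty : ∀ k → matchings [] (A ∪ B) k ≡ 𝟙 (0 ≡ᵇ k)
      empty zero    = refl
      empty (suc k) = refl
    matchings-∪ {x ∷ xs} uxs@(_ ∷ u) l {A} {B} s = step (A x) (B x) refl refl
      where
      step : ∀ a b → A x ≡ a → B x ≡ b → Product (x ∷ xs) A B
      step true  _     Ax _  = Product-step uxs l (matchings-∪ u (<⇒≤ l)) s Ax
      step false true  _  Bx = Product-sym {x ∷ xs} {B} {A}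
        (Product-step uxs l (matchings-∪ u (<⇒≤ l)) (Separated-sym s) Bx)
      step false false Ax Bx k = begin
        matchings (x ∷ xs) (A ∪ B) k   ≡⟨ matchings-out x xs (A ∪ B) k (cong₂ _∨_ Ax Bx) ⟩
        matchings xs (A ∪ B) k         ≡⟨ matchings-∪ u (<⇒≤ l) s k ⟩
        crossingProduct c (suc m) (matchings xs A) (matchings xs B) k
          ≡⟨ crossingProduct-cong c (suc m) (λ a → matchings-out x xs A a Ax)
               (λ b → matchings-out x xs B b Bx) k ⟨
        crossingProduct c (suc m) (matchings (x ∷ xs) A) (matchings (x ∷ xs) B) k ∎

-- Perfect matchings as vertex-by-vertex matchings

private
  false≢true : ¬ (false ≡ true)
  false≢true ()

filter-map : {A B : Set} {P : B → Set} (P? : ∀ b → Dec (P b)) (f : A → B) (xs : List A) →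
             filter P? (map f xs) ≡ map f (filter (P? ∘ f) xs)
filter-map P? f []       = refl
filter-map P? f (x ∷ xs) with P? (f x)
... | yes _ = cong (f x ∷_) (filter-map P? f xs)
... | no _  = filter-map P? f xs

∑-filter : {A : Set} {P : A → Set} (P? : ∀ a → Dec (P a)) (p : A → Bool) (xs : List A) (f : A → ℕ) →
           (∀ {x} → x ∈ xs → P x → p x ≡ true) → (∀ {x} → x ∈ xs → p x ≡ true → P x) →
           ∑ (filter P? xs) f ≡ ∑ xs (λ x → 𝟙 (p x) * f x)
∑-filter P? p []       f to from = refl
∑-filter P? p (x ∷ xs) f to from with P? x | ∑-filter P? p xs f (to ∘ there) (from ∘ there)
... | yes Px | ih rewrite to (here refl) Px = cong₂ _+_ (sym (+-identityʳ (f x))) ih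
... | no ¬Px | ih with p x in px
...   | true  = ⊥-elim (¬Px (from (here refl) px))
...   | false = ih

module Edges {n} (G : Graph (Fin n)) where

  open ≡-Reasoning

  open Matchings _≟_ G

  degree : Fin n → List (Edge n) → ℕ
  degree v M = length (filter (incident? v) M)

  -- Generalises `CoversOnce` to a degree demand of 1 on S and 0 elsewhere, so that choosing an edge
  -- can be undone by lowering the demand at its ends.
  Exact : (Fin n → Bool) → List (Edge n) → Set
  Exact S M = ∀ v → degree v M ≡ 𝟙 (S v)

  exact? : ∀ S M → Dec (Exact S M)
  exact? S M = all? (λ v → degree v M ℕ.≟ 𝟙 (S v))

  exactCovers : List (Edge n) → (Fin n → Bool) → ℕ
  exactCovers E S = length (filter (exact? S) (sublists E))

  degree-∷ : ∀ v e M → degree v (e ∷ M) ≡ 𝟙 ⌊ incident? v e ⌋ + degree v M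
  degree-∷ v (i , j) M with v ≟ i | v ≟ j
  ... | yes _ | _     = refl
  ... | no _  | yes _ = refl
  ... | no _  | no _  = refl

  demand-split : ∀ S {i j} → S i ≡ true → S j ≡ true → ∀ v →
    𝟙 (S v) ≡ 𝟙 ⌊ incident? v (i , j) ⌋ + 𝟙 ((S ∖ i ∖ j) v)
  demand-split S {i} {j} Si Sj v with v ≟ i | v ≟ j
  ... | yes refl | yes _    rewrite Si = refl
  ... | yes refl | no _     rewrite Si = refl
  ... | no _     | yes refl rewrite Sj = refl
  ... | no _     | no _     with S v
  ...   | true  = refl
  ...   | false = refl

  incident-demand : ∀ S {v e M} → Incident v e → Exact S (e ∷ M) → S v ≡ true
  incident-demand S {v} {e} {M} inc ex with S v | ex v
  ... | true  | _ = refl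
  ... | false | d rewrite degree-∷ v e M
    | trans (isYes≗does (incident? v e)) (dec-true (incident? v e) inc) = ⊥-elim (1+n≢0 d)

  -- A sublist containing the head edge can meet the demand only if both ends are demanded, and then
  -- its tail has to meet what remains.
  exactCovers-∷ : ∀ i j E S → exactCovers ((i , j) ∷ E) S ≡
    𝟙 (S i ∧ S j) * exactCovers E (S ∖ i ∖ j) + exactCovers E S
  exactCovers-∷ i j E S = begin
    length (filter (exact? S) (map (e ∷_) (sublists E) ++ sublists E))
      ≡⟨ cong length (filter-++ (exact? S) (map (e ∷_) (sublists E)) _) ⟩
    length (filter (exact? S) (map (e ∷_) (sublists E)) ++ filter (exact? S) (sublists E))
      ≡⟨ length-++ (filter (exact? S) (map (e ∷_) (sublists E))) ⟩
    length (filter (exact? S) (map (e ∷_) (sublists E))) + exactCovers E S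
      ≡⟨ cong (_+ exactCovers E S) (trans (trans
           (cong length (filter-map (exact? S) (e ∷_) (sublists E)))
           (length-map (e ∷_) (filter (exact? S ∘ (e ∷_)) (sublists E))))
           (chosen (S i) (S j) refl refl)) ⟩
    𝟙 (S i ∧ S j) * exactCovers E (S ∖ i ∖ j) + exactCovers E S ∎
    where
    e = i , j
    chosen : ∀ a b → S i ≡ a → S j ≡ b → length (filter (exact? S ∘ (e ∷_)) (sublists E)) ≡
      𝟙 (S i ∧ S j) * exactCovers E (S ∖ i ∖ j)
    chosen true true Si Sj = trans
      (cong length (filter-≐ (exact? S ∘ (e ∷_)) (exact? (S ∖ i ∖ j)) (to , from) (sublists E)))
      (trans (sym (+-identityʳ _)) (cong (λ b → 𝟙 b * exactCovers E (S ∖ i ∖ j)) (sym (cong₂ _∧_ Si Sj))))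
      where
      to : ∀ {M} → Exact S (e ∷ M) → Exact (S ∖ i ∖ j) M
      to {M} ex v = +-cancelˡ-≡ (𝟙 ⌊ incident? v e ⌋) _ _
        (trans (sym (degree-∷ v e M)) (trans (ex v) (demand-split S Si Sj v)))
      from : ∀ {M} → Exact (S ∖ i ∖ j) M → Exact S (e ∷ M)
      from {M} ex v = trans (degree-∷ v e M)
        (trans (cong (λ z → 𝟙 ⌊ incident? v e ⌋ + z) (ex v)) (sym (demand-split S Si Sj v)))
    chosen false b Si _ rewrite Si = cong length (filter-none (exact? S ∘ (e ∷_))
      (All.universal (λ M ex → false≢true (trans (sym Si) (incident-demand S (inj₁ refl) ex))) (sublists E)))
    chosen true false Si Sj rewrite Si | Sj = cong length (filter-none (exact? S ∘ (e ∷_))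
      (All.universal (λ M ex → false≢true (trans (sym Sj) (incident-demand S (inj₂ refl) ex))) (sublists E)))

  Avoids : Fin n → Edge n → Set
  Avoids x (i , j) = x ≢ i × x ≢ j

  exactCovers-avoiding : ∀ {x E} → All (Avoids x) E → ∀ S → S x ≡ true → exactCovers E S ≡ 0
  exactCovers-avoiding {x} []                       S Sx
    rewrite filter-reject (exact? S) {[]} {[]} (λ ex → 1+n≢0 (sym (trans (ex x) (cong 𝟙 Sx)))) = refl
  exactCovers-avoiding {x} {(i , j) ∷ E} ((x≢i , x≢j) ∷ avoids) S Sx
    rewrite exactCovers-∷ i j E S
          | exactCovers-avoiding avoids S Sx
          | exactCovers-avoiding avoids (S ∖ i ∖ j)
              (trans (∖-other (S ∖ i) x≢j) (trans (∖-other S x≢i) Sx))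
    = trans (+-identityʳ _) (*-zeroʳ (𝟙 (S i ∧ S j)))

  star : Fin n → List (Fin n) → List (Edge n)
  star x = map (x ,_)

  exactCovers-star-out : ∀ x js E S → S x ≡ false →
    exactCovers (star x js ++ E) S ≡ exactCovers E S
  exactCovers-star-out x []       E S Sx = refl
  exactCovers-star-out x (j ∷ js) E S Sx
    rewrite exactCovers-∷ x j (star x js ++ E) S | Sx = exactCovers-star-out x js E S Sx

  -- No edge outside the star meets x, so exactly one star edge is chosen; afterwards x demands
  -- nothing and the rest of the star drops out.
  exactCovers-star-in : ∀ x js {E} S → S x ≡ true → All (x ≢_) js → All (Avoids x) E →
    exactCovers (star x js ++ E) S ≡ ∑ js (λ j → 𝟙 (S j) * exactCovers E (S ∖ x ∖ j))
  exactCovers-star-in x []       S Sx []          avoids = exactCovers-avoiding avoids S Sx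
  exactCovers-star-in x (j ∷ js) {E} S Sx (x≢j ∷ x≢js) avoids
    rewrite exactCovers-∷ x j (star x js ++ E) S | Sx = cong₂ _+_
      (cong (𝟙 (S j) *_) (exactCovers-star-out x js E (S ∖ x ∖ j)
        (trans (∖-other (S ∖ x) x≢j) (∖-self S x))))
      (exactCovers-star-in x js S Sx x≢js avoids)

  isEdge? : (e : Edge n) → Dec _
  isEdge? (i , j) = (i <? j) ×-dec T? (adj G i j)

  -- `edges G` is a concatenation of stars, one per vertex in increasing order.
  edgesFrom : List (Fin n) → List (Fin n) → List (Edge n)
  edgesFrom xs ys = filter isEdge? (cartesianProduct xs ys)

  above : Fin n → List (Fin n) → List (Fin n)
  above x = filter (λ j → isEdge? (x , j))

  edgesFrom-∷ : ∀ x xs ys → edgesFrom (x ∷ xs) ys ≡ star x (above x ys) ++ edgesFrom xs ys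
  edgesFrom-∷ x xs ys = trans (filter-++ isEdge? (map (x ,_) ys) _)
    (cong (_++ edgesFrom xs ys) (filter-map isEdge? (x ,_) ys))

  ∑-above : ∀ x (f : Fin n → ℕ) {xs} → All (x <ᶠ_) xs →
    ∑ (above x xs) f ≡ ∑ xs (λ y → 𝟙 (adj G x y) * f y)
  ∑-above x f {xs} x<xs = ∑-filter (λ j → isEdge? (x , j)) (adj G x) xs f
    (λ _ → Equivalence.to T-≡ ∘ proj₂)
    (λ y∈ e → All.lookup x<xs y∈ , Equivalence.from T-≡ e)

  above-prefix : ∀ x pre rest → All (λ y → ¬ (x <ᶠ y)) pre → above x (pre ++ rest) ≡ above x rest
  above-prefix x pre rest h = trans (filter-++ _ pre rest)
    (cong (_++ above x rest) (filter-none _ (All.map (λ ¬lt → ¬lt ∘ proj₁) h)))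

  above-suffix : ∀ {x} pre {xs} → All (_<ᶠ x) pre → above x (pre ++ x ∷ xs) ≡ above x xs
  above-suffix {x} pre {xs} pre<x = trans
    (above-prefix x pre (x ∷ xs) (All.map (λ y<x x<y → <ᶠ-asym y<x x<y) pre<x))
    (filter-reject (λ j → isEdge? (x , j)) {x} {xs} (<ᶠ-irrefl {x = x} refl ∘ proj₁))

  edgesFrom-avoids : ∀ {x xs} ys → All (x <ᶠ_) xs → All (Avoids x) (edgesFrom xs ys)
  edgesFrom-avoids {x} {xs} ys x<xs = All.tabulate avoids
    where
    avoids : ∀ {e} → e ∈ edgesFrom xs ys → Avoids x e
    avoids e∈ with ∈-filter⁻ isEdge? {xs = cartesianProduct xs ys} e∈
    ... | e∈′ , i<j , _ with ∈-cartesianProduct⁻ xs ys e∈′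
    ...   | i∈ , _ = <ᶠ⇒≢ x<i , <ᶠ⇒≢ (<ᶠ-trans x<i i<j)
      where x<i = All.lookup x<xs i∈

  -- Only the first factor of the cartesian product is consumed; the second stays the full list
  -- `ys`. The earlier vertices `pre` lie below every remaining one, hence contribute nothing to the
  -- remaining stars.
  exactCovers-matchings : ∀ pre {xs ys} → ys ≡ pre ++ xs →
    All (λ y → All (y <ᶠ_) xs) pre → AllPairs _<ᶠ_ xs →
    ∀ S → (∀ v → S v ≡ true → v ∈ xs) →
    exactCovers (edgesFrom xs ys) S ≡ matchings xs S 0
  exactCovers-matchings pre {[]} _ _ _ S S⊆ = cong length (filter-accept (exact? S) none)
    where
    none : Exact S []
    none v with S v in Sv
    ... | false = refl
    ... | true  with () ← S⊆ v Sv
  exactCovers-matchings pre {x ∷ xs} {ys} eq pre< (x<xs ∷ xs<) S S⊆ = begin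
    exactCovers (edgesFrom (x ∷ xs) ys) S
      ≡⟨ cong (λ E → exactCovers E S) (edgesFrom-∷ x xs ys) ⟩
    exactCovers (star x (above x ys) ++ E) S
      ≡⟨ cong (λ js → exactCovers (star x js ++ E) S)
           (trans (cong (above x) eq) (above-suffix pre (All.map All.head pre<))) ⟩
    exactCovers (star x (above x xs) ++ E) S
      ≡⟨ step (S x) refl ⟩
    matchings (x ∷ xs) S 0 ∎
    where
    E = edgesFrom xs ys
    x≢ : ∀ {y} → y ∈ xs → y ≢ x
    x≢ y∈ refl = <ᶠ-irrefl refl (All.lookup x<xs y∈)
    drop : ∀ {v} → v ∈ x ∷ xs → v ≢ x → v ∈ xs
    drop (here v≡x) v≢x = ⊥-elim (v≢x v≡x)
    drop (there v∈) _   = v∈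
    ih : ∀ S → S x ≡ false → (∀ v → S v ≡ true → v ∈ x ∷ xs) → exactCovers E S ≡ matchings xs S 0
    ih S Sx S⊆ = exactCovers-matchings (pre ∷ʳ x)
      (trans eq (sym (++-assoc pre (x ∷ []) xs)))
      (All.++⁺ (All.map All.tail pre<) (x<xs ∷ [])) xs< S
      λ v Sv → drop (S⊆ v Sv) λ { refl → false≢true (trans (sym Sx) Sv) }
    -- Choosing an edge removes both ends from the demand, whereas `matchings` removes only the
    -- partner; the two sets agree on `xs`, which does not contain x.
    rest : ∀ {y} → y ∈ xs → exactCovers E (S ∖ x ∖ y) ≡ matchings xs (S ∖ y) 0
    rest {y} y∈ = trans
      (ih (S ∖ x ∖ y) (trans (∖-other (S ∖ x) (≢-sym (x≢ y∈))) (∖-self S x))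
        λ v h → S⊆ v (∖-⊆ S x (∖-⊆ (S ∖ x) y h)))
      (matchings-cong xs (λ z∈ → ∖-cong (S ∖ x) S y (∖-other S (x≢ z∈))) 0)
    step : ∀ t → S x ≡ t → exactCovers (star x (above x xs) ++ E) S ≡ matchings (x ∷ xs) S 0
    step false Sx = trans (exactCovers-star-out x (above x xs) E S Sx)
      (trans (ih S Sx S⊆) (sym (matchings-out x xs S 0 Sx)))
    step true Sx = begin
      exactCovers (star x (above x xs) ++ E) S
        ≡⟨ exactCovers-star-in x (above x xs) S Sx
             (All.filter⁺ _ (All.map <ᶠ⇒≢ x<xs)) (edgesFrom-avoids ys x<xs) ⟩
      ∑ (above x xs) (λ j → 𝟙 (S j) * exactCovers E (S ∖ x ∖ j))
        ≡⟨ ∑-above x _ x<xs ⟩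
      ∑ xs (λ j → 𝟙 (adj G x j) * (𝟙 (S j) * exactCovers E (S ∖ x ∖ j)))
        ≡⟨ ∑-cong-∈ xs (λ {j} j∈ → trans (cong (λ z → 𝟙 (adj G x j) * (𝟙 (S j) * z)) (rest j∈))
             (trans (merge (𝟙 (adj G x j)) (𝟙 (S j)) _)
               (cong (_* matchings xs (S ∖ j) 0) (sym (𝟙-∧ (S j) (adj G x j)))))) ⟩
      partners x xs S 0
        ≡⟨ matchings-in x xs S 0 Sx ⟨
      matchings (x ∷ xs) S 0 ∎
      where
      merge : ∀ a s z → a * (s * z) ≡ s * a * z
      merge = solve-∀

  -- For the demand that is 1 everywhere, `exact?` computes to `coversOnce?`.
  perfectMatchings-count : length (perfectMatchings G) ≡ matchings (allFin n) (λ _ → true) 0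
  perfectMatchings-count = exactCovers-matchings [] refl [] (tabulate⁺-< id) (λ _ → true) (λ v _ → ∈-allFin v)

-- Twins in cographs

-- True and false twins alike: whether u and v are adjacent is left open.
Twins : {V : Set} → Graph V → (V → Bool) → V → V → Set
Twins G S u v = S u ≡ true × S v ≡ true × u ≢ v ×
  (∀ w → S w ≡ true → w ≢ u → w ≢ v → adj G u w ≡ adj G v w)

data Reducible {V : Set} (G : Graph V) (S : V → Bool) : Set where
  empty     : (∀ v → S v ≡ false) → Reducible G S
  singleton : ∀ u → S u ≡ true → (∀ v → S v ≡ true → v ≡ u) → Reducible G S
  twins     : ∀ u v → Twins G S u v → Reducible G S

private
  clash : ∀ {b} {A : Set} → b ≡ false → b ≡ true → A
  clash refl ()

-- Twins within a summand remain twins because every vertex of the other summand sees both in the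
-- same way. If each summand has a single member, these two are twins vacuously.
reducible-sum : ∀ {b} {V W : Set} {G : Graph V} {H : Graph W} {S : V ⊎ W → Bool} →
  Reducible G (λ v → S (inj₁ v)) → Reducible H (λ w → S (inj₂ w)) → Reducible (sum b G H) S
reducible-sum (twins u v (Su , Sv , u≢v , same)) _ =
  twins (inj₁ u) (inj₁ v) (Su , Sv , (λ { refl → u≢v refl }) , λ where
    (inj₁ w) Sw w≢u w≢v → same w Sw (λ { refl → w≢u refl }) (λ { refl → w≢v refl })
    (inj₂ w) _ _ _ → refl)
reducible-sum _ (twins u v (Su , Sv , u≢v , same)) =
  twins (inj₂ u) (inj₂ v) (Su , Sv , (λ { refl → u≢v refl }) , λ where
    (inj₁ w) _ _ _ → refl
    (inj₂ w) Sw w≢u w≢v → same w Sw (λ { refl → w≢u refl }) (λ { refl → w≢v refl }))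
reducible-sum (empty e) (empty f) = empty λ where
  (inj₁ v) → e v
  (inj₂ w) → f w
reducible-sum (empty e) (singleton u Su only) = singleton (inj₂ u) Su λ where
  (inj₁ v) Sv → clash (e v) Sv
  (inj₂ w) Sw → cong inj₂ (only w Sw)
reducible-sum (singleton u Su only) (empty e) = singleton (inj₁ u) Su λ where
  (inj₁ v) Sv → cong inj₁ (only v Sv)
  (inj₂ w) Sw → clash (e w) Sw
reducible-sum (singleton u Su onlyU) (singleton v Sv onlyV) =
  twins (inj₁ u) (inj₂ v) (Su , Sv , (λ ()) , λ where
    (inj₁ w) Sw w≢u _ → ⊥-elim (w≢u (cong inj₁ (onlyU w Sw)))
    (inj₂ w) Sw _ w≢v → ⊥-elim (w≢v (cong inj₂ (onlyV w Sw))))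

reducible-≅ : {V W : Set} {G : Graph V} {H : Graph W} (i : G ≅ H) {S : W → Bool} →
  Reducible G (λ v → S (Inverse.to (_≅_.vertices i) v)) → Reducible H S
reducible-≅ {H = H} i {S} = λ where
    (empty e) → empty λ w → trans (cong S (sym (to-from w))) (e (from w))
    (singleton u Su only) → singleton (to u) Su λ w Sw →
      trans (sym (to-from w)) (cong to (only (from w) (member w Sw)))
    (twins u v (Su , Sv , u≢v , same)) → twins (to u) (to v)
      (Su , Sv , (λ e → u≢v (injective e)) , λ w Sw w≢u w≢v →
        subst (λ x → adj H (to u) x ≡ adj H (to v) x) (to-from w)
          (trans (sym (adj-pres u (from w)))
            (trans (same (from w) (member w Sw)
                     (λ e → w≢u (trans (sym (to-from w)) (cong to e)))
                     (λ e → w≢v (trans (sym (to-from w)) (cong to e))))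
                   (adj-pres v (from w)))))
  where
  open _≅_ i
  open Inverse vertices using (to; from; strictlyInverseˡ; strictlyInverseʳ)
  to-from = strictlyInverseˡ
  injective : ∀ {u v} → to u ≡ to v → u ≡ v
  injective {u} {v} e =
    trans (sym (strictlyInverseʳ u)) (trans (cong from e) (strictlyInverseʳ v))
  member : ∀ w → S w ≡ true → S (to (from w)) ≡ true
  member w Sw = trans (cong S (to-from w)) Sw

-- A trichotomy, because V is arbitrary: two members of S cannot be searched for.
reducible : {V : Set} {G : Graph V} → Cograph G → ∀ S → Reducible G S
reducible single S with S tt in eq
... | true  = singleton tt eq λ _ _ → refl
... | false = empty λ _ → eq
reducible (union g h)   S = reducible-sum (reducible g _) (reducible h _)
reducible (join g h)    S = reducible-sum (reducible g _) (reducible h _)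
reducible (relabel i g) S = reducible-≅ i (reducible g _)

-- Excludes n = 0, where no vertex 0 could hold the result.
inhabited : {V : Set} {G : Graph V} → Cograph G → V
inhabited single        = tt
inhabited (union g _)   = inj₁ (inhabited g)
inhabited (join g _)    = inj₁ (inhabited g)
inhabited (relabel i g) = Inverse.to (_≅_.vertices i) (inhabited g)

-- Decisions and pointwise updates

⌊⌋-true : {A : Set} (a? : Dec A) → A → ⌊ a? ⌋ ≡ true
⌊⌋-true a? a = trans (isYes≗does a?) (dec-true a? a)

⌊⌋-false : {A : Set} (a? : Dec A) → ¬ A → ⌊ a? ⌋ ≡ false
⌊⌋-false a? ¬a = trans (isYes≗does a?) (dec-false a? ¬a)

update-same : {A : Set} (f : ℕ → A) (x : ℕ) (v : A) → update ℕ._≟_ f x v x ≡ v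
update-same f x v rewrite ⌊⌋-true (x ℕ.≟ x) refl = refl

update-other : {A : Set} (f : ℕ → A) {x y : ℕ} (v : A) → y ≢ x → update ℕ._≟_ f x v y ≡ f y
update-other f {x} {y} v y≢x rewrite ⌊⌋-false (y ℕ.≟ x) y≢x = refl

-- Bounded-loop programs over natural numbers

record Store : Set where
  constructor store
  field
    nvar : ℕ → ℕ
    narr : ℕ → ℕ → ℕ

open Store public

setN : ℕ → ℕ → Store → Store
setN x v σ = store (update ℕ._≟_ (nvar σ) x v) (narr σ)

setA : ℕ → ℕ → ℕ → Store → Store
setA a i v σ = store (nvar σ) (update ℕ._≟_ (narr σ) a (update ℕ._≟_ (narr σ a) i v))

infixl 7 _⊠_
infixl 6 _⊞_
infixr 8 _at_
infixr 2 _⨾_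

data Term : Set where
  num     : ℕ → Term
  get     : ℕ → Term
  _at_    : ℕ → Term → Term
  _⊞_ _⊠_ : Term → Term → Term

eval : Term → Store → ℕ
eval (num k)  σ = k
eval (get x)  σ = nvar σ x
eval (a at t) σ = narr σ a (eval t σ)
eval (t ⊞ u)  σ = eval t σ + eval u σ
eval (t ⊠ u)  σ = eval t σ * eval u σ

-- The index bounds the nesting depth of loops. The loop `for x p` lets x run
-- from 0 to the value of variable 1, exclusively; `setPred` is truncated
-- predecessor.
data Stmt : ℕ → Set where
  nop     : ∀ {d} → Stmt d
  set     : ∀ {d} → ℕ → Term → Stmt d
  setPred : ∀ {d} → ℕ → Term → Stmt d
  put     : ∀ {d} → ℕ → Term → Term → Stmt d
  _⨾_     : ∀ {d} → Stmt d → Stmt d → Stmt d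
  ifEq    : ∀ {d} → Term → Term → Stmt d → Stmt d → Stmt d
  for     : ∀ {d} → ℕ → Stmt d → Stmt (suc d)

-- For a concrete statement and variable this computes to a product of `⊤`s, so the implicit side
-- conditions of `vars` and `arrays` are solved by unification.
Untouched : ∀ {d} → ℕ → Stmt d → Set
Untouched y nop            = ⊤
Untouched y (set x _)      = T (not (y ≡ᵇ x))
Untouched y (setPred x _)  = T (not (y ≡ᵇ x))
Untouched y (put _ _ _)    = ⊤
Untouched y (p ⨾ q)        = Untouched y p × Untouched y q
Untouched y (ifEq _ _ p q) = Untouched y p × Untouched y q
Untouched y (for x p)      = T (not (y ≡ᵇ x)) × Untouched y p

UntouchedArray : ∀ {d} → ℕ → Stmt d → Set
UntouchedArray b nop            = ⊤
UntouchedArray b (set _ _)      = ⊤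
UntouchedArray b (setPred _ _)  = ⊤
UntouchedArray b (put a _ _)    = T (not (b ≡ᵇ a))
UntouchedArray b (p ⨾ q)        = UntouchedArray b p × UntouchedArray b q
UntouchedArray b (ifEq _ _ p q) = UntouchedArray b p × UntouchedArray b q
UntouchedArray b (for _ p)      = UntouchedArray b p

-- A body that changed its own counter would make the compiled `while` deviate from the fixed number
-- of rounds of `exec`.
LoopsOk : ∀ {d} → Stmt d → Set
LoopsOk (p ⨾ q)        = LoopsOk p × LoopsOk q
LoopsOk (ifEq _ _ p q) = LoopsOk p × LoopsOk q
LoopsOk (for x p)      = Untouched x p × LoopsOk p
LoopsOk _              = ⊤

untouched⇒≢ : ∀ y x → T (not (y ≡ᵇ x)) → y ≢ x
untouched⇒≢ y .y t refl with y ≡ᵇ y | ≡⇒≡ᵇ y y refl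
... | true | _ = t

record Unchanged {d} (p : Stmt d) (σ τ : Store) : Set where
  field
    vars   : ∀ y {_ : Untouched y p} → nvar τ y ≡ nvar σ y
    arrays : ∀ a {_ : UntouchedArray a p} → narr τ a ≡ narr σ a

open Unchanged public

module _ (m : ℕ) where

  exec    : ∀ {d} → Stmt d → Store → Store
  forFrom : ∀ {d} → ℕ → Stmt d → ℕ → ℕ → Store → Store

  exec nop            σ = σ
  exec (set x t)      σ = setN x (eval t σ) σ
  exec (setPred x t)  σ = setN x (pred (eval t σ)) σ
  exec (put a i t)    σ = setA a (eval i σ) (eval t σ) σ
  exec (p ⨾ q)        σ = exec q (exec p σ)
  exec (ifEq t u p q) σ = if ⌊ eval t σ ℕ.≟ eval u σ ⌋ then exec p σ else exec q σ
  exec (for x p)      σ = forFrom x p m 0 σ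

  -- The counter ends at the bound, as it does when the compiled `while` exits.
  forFrom x p zero    i σ = setN x i σ
  forFrom x p (suc k) i σ = forFrom x p k (suc i) (exec p (setN x i σ))

  -- Loops are not analysed any further; `exec-for` takes care of them.
  wp : ∀ {d} → Stmt d → (Store → Set) → Store → Set
  wp nop            Q σ = Q σ
  wp (set x t)      Q σ = Q (setN x (eval t σ) σ)
  wp (setPred x t)  Q σ = Q (setN x (pred (eval t σ)) σ)
  wp (put a i t)    Q σ = Q (setA a (eval i σ) (eval t σ) σ)
  wp (p ⨾ q)        Q σ = wp p (wp q Q) σ
  wp (ifEq t u p q) Q σ = (eval t σ ≡ eval u σ → wp p Q σ) × (eval t σ ≢ eval u σ → wp q Q σ)
  wp (for x p)      Q σ = Q (exec (for x p) σ)

  wp-sound : ∀ {d} (p : Stmt d) {Q : Store → Set} σ → wp p Q σ → Q (exec p σ)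
  wp-sound nop            σ w = w
  wp-sound (set x t)      σ w = w
  wp-sound (setPred x t)  σ w = w
  wp-sound (put a i t)    σ w = w
  wp-sound (p ⨾ q)        σ w = wp-sound q (exec p σ) (wp-sound p σ w)
  wp-sound (ifEq t u p q) σ (w , v) with eval t σ ℕ.≟ eval u σ
  ... | yes e = wp-sound p σ (w e)
  ... | no ne = wp-sound q σ (v ne)
  wp-sound (for x p)      σ w = w

  exec-var    : ∀ {d} (p : Stmt d) σ y → Untouched y p → nvar (exec p σ) y ≡ nvar σ y
  forFrom-var : ∀ {d} x (p : Stmt d) k i σ y → y ≢ x → Untouched y p →
                nvar (forFrom x p k i σ) y ≡ nvar σ y

  exec-var nop            σ y _       = refl
  exec-var (set x t)      σ y u       = update-other (nvar σ) _ (untouched⇒≢ y x u)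
  exec-var (setPred x t)  σ y u       = update-other (nvar σ) _ (untouched⇒≢ y x u)
  exec-var (put a i t)    σ y _       = refl
  exec-var (p ⨾ q)        σ y (u , v) = trans (exec-var q (exec p σ) y v) (exec-var p σ y u)
  exec-var (ifEq t w p q) σ y (u , v) with ⌊ eval t σ ℕ.≟ eval w σ ⌋
  ... | true  = exec-var p σ y u
  ... | false = exec-var q σ y v
  exec-var (for x p)      σ y (u , v) = forFrom-var x p m 0 σ y (untouched⇒≢ y x u) v

  forFrom-var x p zero    i σ y y≢x u = update-other (nvar σ) i y≢x
  forFrom-var x p (suc k) i σ y y≢x u =
    trans (forFrom-var x p k (suc i) (exec p (setN x i σ)) y y≢x u)
      (trans (exec-var p (setN x i σ) y u) (update-other (nvar σ) i y≢x))

  exec-array    : ∀ {d} (p : Stmt d) σ b → UntouchedArray b p → narr (exec p σ) b ≡ narr σ b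
  forFrom-array : ∀ {d} x (p : Stmt d) k i σ b → UntouchedArray b p →
                  narr (forFrom x p k i σ) b ≡ narr σ b

  exec-array nop            σ b _       = refl
  exec-array (set x t)      σ b _       = refl
  exec-array (setPred x t)  σ b _       = refl
  exec-array (put a i t)    σ b u       = update-other (narr σ) _ (untouched⇒≢ b a u)
  exec-array (p ⨾ q)        σ b (u , v) = trans (exec-array q (exec p σ) b v) (exec-array p σ b u)
  exec-array (ifEq t w p q) σ b (u , v) with ⌊ eval t σ ℕ.≟ eval w σ ⌋
  ... | true  = exec-array p σ b u
  ... | false = exec-array q σ b v
  exec-array (for x p)      σ b u       = forFrom-array x p m 0 σ b u

  forFrom-array x p zero    i σ b u = refl
  forFrom-array x p (suc k) i σ b u =
    trans (forFrom-array x p k (suc i) (exec p (setN x i σ)) b u) (exec-array p (setN x i σ) b u)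

  exec-unchanged : ∀ {d} (p : Stmt d) σ → Unchanged p σ (exec p σ)
  exec-unchanged p σ = record
    { vars   = λ y {u} → exec-var p σ y u
    ; arrays = λ a {u} → exec-array p σ a u }

  -- The invariant is stated for the store in which the loop variable has just
  -- been set, so that it holds literally at the head of the loop.
  exec-for : ∀ {d} x (p : Stmt d) σ (I : ℕ → Store → Set) →
    I 0 (setN x 0 σ) →
    (∀ i τ → i < m → nvar τ x ≡ i → Unchanged (for x p) σ τ → I i τ →
       I (suc i) (setN x (suc i) (exec p τ))) →
    I m (exec (for x p) σ)
  exec-for {d} x p σ I base step = subst (λ j → I j (exec (for x p) σ)) (+-identityʳ m)
    (go m 0 σ (≤-reflexive (+-identityʳ m))
      (record { vars = λ _ → refl ; arrays = λ _ → refl }) base)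
    where
    go : ∀ k i τ → k + i ≤ m → Unchanged (for x p) σ τ → I i (setN x i τ) →
         I (k + i) (forFrom x p k i τ)
    go zero    i τ _ _ h = h
    go (suc k) i τ l c h = subst (λ j → I j (forFrom x p k (suc i) τ″)) (+-suc k i)
      (go k (suc i) τ″ (subst (_≤ m) (sym (+-suc k i)) l)
        (record
          { vars   = λ { y {u , v} → trans (exec-var p τ′ y v) (vars c′ y {u , v}) }
          ; arrays = λ a {u} → trans (exec-array p τ′ a u) (arrays c′ a {u}) })
        (step i τ′ (≤-trans (s≤s (m≤n+m i k)) l) (update-same (nvar τ) x i) c′ h))
      where
      τ′ = setN x i τ
      τ″ = exec p τ′
      c′ : Unchanged (for x p) σ τ′
      c′ = record
        { vars   = λ { y {u , v} → trans (update-other (nvar τ) i (untouched⇒≢ y x u)) (vars c y {u , v}) }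
        ; arrays = λ a {u} → arrays c a {u} }

  exec-⨾-ifEq : ∀ {d t u} {s p q : Stmt d} (Q : Store → Set) σ →
    (eval t (exec s σ) ≡ eval u (exec s σ) → Q (exec p (exec s σ))) →
    (eval t (exec s σ) ≢ eval u (exec s σ) → Q (exec q (exec s σ))) →
    Q (exec (s ⨾ ifEq t u p q) σ)
  exec-⨾-ifEq {t = t} {u} {s} Q σ yesQ noQ with eval t (exec s σ) ℕ.≟ eval u (exec s σ)
  ... | yes e = yesQ e
  ... | no ne = noQ ne

-- Compilation

compileTerm : Term → Expr
compileTerm (num k)  = lit (+ k)
compileTerm (get x)  = ` x
compileTerm (a at t) = a ‼ compileTerm t
compileTerm (t ⊞ u)  = compileTerm t ⊕ compileTerm u
compileTerm (t ⊠ u)  = compileTerm t ⊗ compileTerm u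

compile : ∀ {d} → Stmt d → Program
compile nop            = skip
compile (set x t)      = x ≔ compileTerm t
compile (setPred x t)  =
  ifₚ (compileTerm t =ₑ lit (+ 0)) (x ≔ lit (+ 0)) (x ≔ compileTerm t ⊖ lit (+ 1))
compile (put a i t)    = a [ compileTerm i ]≔ compileTerm t
compile (p ⨾ q)        = compile p ⨟ compile q
compile (ifEq t u p q) = ifₚ (compileTerm t =ₑ compileTerm u) (compile p) (compile q)
compile (for x p)      =
  -- Tests offer only ≤ and =, so x < m is expressed as x + 1 ≤ m.
  x ≔ lit (+ 0) ⨟ while (` x ⊕ lit (+ 1) ≤ₑ ` 1) (compile p ⨟ x ≔ ` x ⊕ lit (+ 1))

costTerm : Term → ℕ
costTerm t = cost (compileTerm t)

-- The coefficient of (n + 1) ^ d in the time bound. The two branches of a conditional are added, as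
-- an upper bound for their maximum.
work : ∀ {d} → Stmt d → ℕ
work nop            = 1
work (set x t)      = suc (costTerm t)
work (setPred x t)  = suc (suc (costTerm t + 1)) + suc (suc (costTerm t + 1))
work (put a i t)    = suc (costTerm i + costTerm t)
work (p ⨾ q)        = work p + work q
work (ifEq t u p q) = suc (suc (costTerm t + costTerm u)) + (work p + work q)
-- Setting the counter costs 2, the failing test 6, and each round 6 for the test plus 4 for the
-- increment; 2 + 6 + 10 = 18.
work (for x p)      = 18 + work p

-- Negative indices are left unconstrained, since every term evaluates to a natural number.
record Represents (σ : Store) (s : State) : Set where
  field
    var≡ : ∀ x → var s x ≡ + nvar σ x
    arr≡ : ∀ a i → arr s a (+ i) ≡ + narr σ a i

open Represents

eval-correct : ∀ {σ s} → Represents σ s → ∀ t → ⟦ compileTerm t ⟧ s ≡ + eval t σ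
eval-correct r (num k)  = refl
eval-correct r (get x)  = var≡ r x
eval-correct {σ} {s} r (a at t) = trans (cong (arr s a) (eval-correct r t)) (arr≡ r a (eval t σ))
eval-correct {σ} r (t ⊞ u)  =
  trans (cong₂ ℤ._+_ (eval-correct r t) (eval-correct r u)) (sym (ℤ.pos-+ (eval t σ) (eval u σ)))
eval-correct {σ} r (t ⊠ u)  =
  trans (cong₂ ℤ._*_ (eval-correct r t) (eval-correct r u)) (sym (ℤ.pos-* (eval t σ) (eval u σ)))

represents-setVar : ∀ {σ s} → Represents σ s → ∀ x {z v} → z ≡ + v →
                    Represents (setN x v σ) (setVar x z s)
represents-setVar {σ} {s} r x {z} {v} z≡ = record { var≡ = eq ; arr≡ = arr≡ r }
  where
  eq : ∀ y → var (setVar x z s) y ≡ + nvar (setN x v σ) y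
  eq y with ⌊ y ℕ.≟ x ⌋
  ... | true  = z≡
  ... | false = var≡ r y

represents-setArr : ∀ {σ s} → Represents σ s → ∀ a {j i z v} → j ≡ + i → z ≡ + v →
                    Represents (setA a i v σ) (setArr a j z s)
represents-setArr {σ} {s} r a {_} {i} {z} {v} refl z≡ = record { var≡ = var≡ r ; arr≡ = eq }
  where
  eq : ∀ b k → arr (setArr a (+ i) z s) b (+ k) ≡ + narr (setA a i v σ) b k
  eq b k with ⌊ b ℕ.≟ a ⌋
  ... | false = arr≡ r b k
  ... | true  with k ℕ.≟ i
  ...   | yes refl = z≡
  ...   | no _     = arr≡ r a k

module _ (n : ℕ) where

  private m = suc n

  record Simulated (p : Program) (s : State) (σ : Store) (b : ℕ) : Set where
    constructor simulated
    field
      {end}      : State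
      {time}     : ℕ
      run        : ⟨ p , s ⟩⇓⟨ end , time ⟩
      represents : Represents σ end
      bounded    : time ≤ b

  ≤-scale : ∀ d {k w} → k ≤ w → k ≤ w * m ^ d
  ≤-scale d {k} {w} k≤w = ≤-trans k≤w (m≤m*n w (m ^ d) ⦃ m^n≢0 m d ⦄)

  loopTest : ℕ → Test
  loopTest x = ` x ⊕ lit (+ 1) ≤ₑ ` 1

  loopTest-value : ∀ {x s i} → var s x ≡ + i → var s 1 ≡ + m → ⟦ loopTest x ⟧ᵗ s ≡ ⌊ + (i + 1) ℤ.≤? + m ⌋
  loopTest-value {x} {s} {i} vx v1 rewrite vx | v1 = refl

  -- Each loop raises the exponent by one, and constant costs are absorbed because m is positive.
  -- The bound m is stored in variable 1, which p therefore must not change.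
  compile-correct : ∀ {d} (p : Stmt d) → LoopsOk p → Untouched 1 p →
    ∀ {σ s} → Represents σ s → nvar σ 1 ≡ m →
    Simulated (compile p) s (exec m p σ) (work p * m ^ d)
  while-correct : ∀ {d} x (p : Stmt d) → LoopsOk p → Untouched x p → Untouched 1 p → 1 ≢ x →
    ∀ k i {σ s} → k + i ≡ m → Represents (setN x i σ) s → nvar σ 1 ≡ m →
    Simulated (while (loopTest x) (compile p ⨟ x ≔ ` x ⊕ lit (+ 1))) s (forFrom m x p k i σ)
      (6 + k * (10 + work p * m ^ d))

  compile-correct {d} nop ok u r v1 = simulated ⇓skip r (≤-scale d ≤-refl)
  compile-correct {d} (set x t) ok u r v1 =
    simulated ⇓var (represents-setVar r x (eval-correct r t)) (≤-scale d ≤-refl)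
  compile-correct {d} (setPred x t) ok u {σ} {s} r v1 with eval t σ in et
  ... | zero = simulated (⇓true test ⇓var) (represents-setVar r x refl) (≤-scale d
    (+-monoʳ-≤ (suc (suc (costTerm t + 1))) {2} (s≤s (s≤s z≤n))))
    where
    test : ⌊ ⟦ compileTerm t ⟧ s ℤ.≟ + 0 ⌋ ≡ true
    test = ⌊⌋-true (⟦ compileTerm t ⟧ s ℤ.≟ + 0) (trans (eval-correct r t) (cong +_ et))
  ... | suc k = simulated (⇓false test ⇓var)
    (represents-setVar r x (trans (cong (ℤ._- + 1) value) refl))
    (≤-scale d ≤-refl)
    where
    value : ⟦ compileTerm t ⟧ s ≡ + suc k
    value = trans (eval-correct r t) (cong +_ et)
    test : ⌊ ⟦ compileTerm t ⟧ s ℤ.≟ + 0 ⌋ ≡ false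
    test = ⌊⌋-false (⟦ compileTerm t ⟧ s ℤ.≟ + 0) λ e → 1+n≢0 (ℤ.+-injective (trans (sym value) e))
  compile-correct {d} (put a i t) ok u r v1 =
    simulated ⇓arr (represents-setArr r a (eval-correct r i) (eval-correct r t)) (≤-scale d ≤-refl)
  compile-correct {d} (p ⨾ q) (okp , okq) (up , uq) {σ} r v1
    with compile-correct p okp up r v1
  ... | simulated runp rp bp
    with compile-correct q okq uq rp (trans (exec-var m p σ 1 up) v1)
  ...   | simulated runq rq bq = simulated (⇓seq runp runq) rq
    (≤-trans (+-mono-≤ bp bq) (≤-reflexive (sym (*-distribʳ-+ (m ^ d) (work p) (work q)))))
  compile-correct {d} (ifEq t w p q) (okp , okq) (up , uq) {σ} {s} r v1
    with eval t σ ℕ.≟ eval w σ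
  ... | yes e with simulated run rp b ← compile-correct p okp up r v1 =
    simulated (⇓true (⌊⌋-true (⟦ compileTerm t ⟧ s ℤ.≟ ⟦ compileTerm w ⟧ s)
      (trans (eval-correct r t) (trans (cong +_ e) (sym (eval-correct r w))))) run) rp
      (≤-trans (+-mono-≤ (≤-scale d (≤-refl {suc (suc (costTerm t + costTerm w))}))
          (≤-trans b (*-monoˡ-≤ (m ^ d) (m≤m+n (work p) (work q)))))
        (≤-reflexive (sym (*-distribʳ-+ (m ^ d) (suc (suc (costTerm t + costTerm w))) (work p + work q)))))
  ... | no ne with simulated run rq b ← compile-correct q okq uq r v1 =
    simulated (⇓false (⌊⌋-false (⟦ compileTerm t ⟧ s ℤ.≟ ⟦ compileTerm w ⟧ s)
      (λ e → ne (ℤ.+-injective (trans (sym (eval-correct r t)) (trans e (eval-correct r w)))))) run) rq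
      (≤-trans (+-mono-≤ (≤-scale d (≤-refl {suc (suc (costTerm t + costTerm w))}))
          (≤-trans b (*-monoˡ-≤ (m ^ d) (m≤n+m (work q) (work p)))))
        (≤-reflexive (sym (*-distribʳ-+ (m ^ d) (suc (suc (costTerm t + costTerm w))) (work p + work q)))))
  compile-correct {suc d} (for x p) (ux , okp) (1≢x , u1) {σ} r v1
    with while-correct x p okp ux u1 (untouched⇒≢ 1 x 1≢x) m 0 {σ} (+-identityʳ m)
           (represents-setVar r x refl) v1
  ... | simulated run rp b = simulated (⇓seq ⇓var run) rp (≤-trans (+-monoʳ-≤ 2 b) bound)
    where
    open ≤-Reasoning
    W = work p * m ^ d
    N = m * m ^ d
    regroup : ∀ m p w → m * (10 + w * p) ≡ 10 * m + w * (m * p)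
    regroup = solve-∀
    bound : 2 + (6 + m * (10 + W)) ≤ (18 + work p) * N
    bound = begin
      8 + m * (10 + W)                ≡⟨ cong (λ z → 8 + z) (regroup m (m ^ d) (work p)) ⟩
      8 + (10 * m + work p * N)       ≤⟨ +-mono-≤ (≤-scale (suc d) (≤-refl {8}))
                                          (+-monoˡ-≤ (work p * N) (*-monoʳ-≤ 10 (m≤m*n m (m ^ d) ⦃ m^n≢0 m d ⦄))) ⟩
      8 * N + (10 * N + work p * N)   ≡⟨ cong (λ z → 8 * N + z) (*-distribʳ-+ N 10 (work p)) ⟨
      8 * N + (10 + work p) * N       ≡⟨ *-distribʳ-+ N 8 (10 + work p) ⟨
      (18 + work p) * N               ∎

  while-correct x p okp ux u1 1≢x zero i {σ} {s} e r v1 = simulated (⇓exit test) r ≤-refl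
    where
    test : ⟦ loopTest x ⟧ᵗ s ≡ false
    test = trans (loopTest-value {x} {s} (trans (var≡ r x) (cong +_ (update-same (nvar σ) x i)))
        (trans (var≡ r 1) (cong +_ (trans (update-other (nvar σ) i 1≢x) v1))))
      (⌊⌋-false (+ (i + 1) ℤ.≤? + m) λ { (+≤+ l) → <-irrefl e (subst (_≤ m) (+-comm i 1) l) })
  while-correct {d} x p okp ux u1 1≢x (suc k) i {σ} {s} e r v1
    with v1′ ← trans (update-other (nvar σ) i 1≢x) v1
    with compile-correct p okp u1 r v1′
  ... | simulated runp rp bp
    with while-correct x p okp ux u1 1≢x k (suc i) {exec m p (setN x i σ)}
           (trans (+-suc k i) e)
           (represents-setVar rp x (trans (cong (ℤ._+ + 1) (trans (var≡ rp x)
              (cong +_ (trans (exec-var m p (setN x i σ) x ux) (update-same (nvar σ) x i)))))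
              (cong +_ (+-comm i 1))))
           (trans (exec-var m p (setN x i σ) 1 u1) v1′)
  ...   | simulated runw rw bw = simulated (⇓repeat test (⇓seq runp ⇓var) runw) rw
    (≤-trans (+-monoʳ-≤ 6 (+-mono-≤ (+-monoˡ-≤ 4 bp) bw)) (≤-reflexive (regroup (work p * m ^ d) _)))
    where
    regroup : ∀ w z → 6 + (w + 4 + (6 + z)) ≡ 6 + (10 + w + z)
    regroup = solve-∀
    test : ⟦ loopTest x ⟧ᵗ s ≡ true
    test = trans (loopTest-value {x} {s} (trans (var≡ r x) (cong +_ (update-same (nvar σ) x i)))
        (trans (var≡ r 1) (cong +_ v1′)))
      (⌊⌋-true (+ (i + 1) ℤ.≤? + m) (+≤+ (subst₂ _≤_ (+-comm 1 i) e (s≤s (m≤n+m i k)))))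

-- The program

pattern #N     = 0
pattern #M     = 1
pattern #step  = 2
pattern #u     = 3
pattern #v     = 4
pattern #w     = 5
pattern #ok    = 6
pattern #found = 7
pattern #fu    = 8
pattern #fv    = 9
pattern #c     = 10
pattern #a     = 11
pattern #b     = 12
pattern #k     = 13
pattern #acc   = 14
pattern #row   = 15
pattern #a⁻    = 16
pattern #b⁻    = 17
pattern #k⁻    = 18
pattern #prev  = 19

pattern #adj    = 0
pattern #alive  = 1
pattern #poly   = 2
pattern #table  = 3
pattern #result = 4

-- The input matrix has rows of length n, whereas the arrays indexed by `polyIndex` and `tableIndex`
-- have rows of length n + 1.
adjAt : ℕ → ℕ → Term
adjAt x y = #adj at (get #N ⊠ get x ⊞ get y)

polyIndex : ℕ → ℕ → Term
polyIndex x k = get #M ⊠ get x ⊞ get k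

tableIndex : ℕ → ℕ → ℕ → Term
tableIndex a b k = get #M ⊠ (get #M ⊠ get a ⊞ get b) ⊞ get k

initialiseVertex : Stmt 3
initialiseVertex = put #alive (get #u) (num 1) ⨾ put #poly (get #M ⊠ get #u ⊞ num 1) (num 1)

-- All loops run up to n inclusively, since a polynomial has n + 1 coefficients,
-- so n itself has to be marked as absent.
initialise : Stmt 4
initialise = for #u initialiseVertex ⨾ put #alive (get #N) (num 0)

checkVertex : Stmt 0
checkVertex =
  ifEq (#alive at get #w) (num 1)
    (ifEq (get #w) (get #u) nop
      (ifEq (get #w) (get #v) nop
        (ifEq (adjAt #u #w) (adjAt #v #w) nop (set #ok (num 0)))))
    nop

-- Only a nonzero v is merged away, so that vertex 0 survives to hold the result.
checkPair : Stmt 1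
checkPair =
  ifEq (#alive at get #u) (num 1)
    (ifEq (#alive at get #v) (num 1)
      (ifEq (get #v) (num 0) nop
        (ifEq (get #u) (get #v) nop
          (set #ok (num 1) ⨾
           for #w checkVertex ⨾
           ifEq (get #ok) (num 1)
             (set #found (num 1) ⨾ set #fu (get #u) ⨾ set #fv (get #v))
             nop)))
      nop)
    nop

-- There is no early exit: later twins overwrite earlier ones, and the cost is cubic in any case.
search : Stmt 3
search = set #found (num 0) ⨾ for #u (for #v checkPair)

tableEntry : Stmt 0
tableEntry =
  ifEq (get #a) (num 0)
    (ifEq (get #b) (get #k)
      (put #table (tableIndex #a #b #k) (num 1))
      (put #table (tableIndex #a #b #k) (num 0)))
    (setPred #a⁻ (get #a) ⨾
     setPred #b⁻ (get #b) ⨾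
     setPred #k⁻ (get #k) ⨾
     ifEq (get #k) (num 0)
       (set #prev (num 0))
       (set #prev (#table at tableIndex #a⁻ #b #k⁻)) ⨾
     put #table (tableIndex #a #b #k)
       -- For b = 0 the entry at `#b⁻` is read at 0 as well, but multiplied by b.
       (get #prev ⊞ get #c ⊠ (get #b ⊠ #table at tableIndex #a⁻ #b⁻ #k)))

fillTable : Stmt 3
fillTable = for #a (for #b (for #k tableEntry))

multiply : Stmt 3
multiply =
  for #k
    (set #acc (num 0) ⨾
     for #a
       (set #row (num 0) ⨾
        for #b
          (set #row ((#poly at polyIndex #fv #b) ⊠ (#table at tableIndex #a #b #k) ⊞ get #row)) ⨾
        set #acc ((#poly at polyIndex #fu #a) ⊠ get #row ⊞ get #acc)) ⨾
     put #result (get #k) (get #acc))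

-- The product is collected in `#result` because each of its coefficients needs the whole old
-- polynomial of `#fu`.
copy : Stmt 3
copy = for #k (put #poly (polyIndex #fu #k) (#result at get #k))

merge : Stmt 3
merge =
  set #c (adjAt #fu #fv) ⨾ fillTable ⨾ multiply ⨾ copy ⨾ put #alive (get #fv) (num 0)

eliminate : Stmt 3
eliminate = search ⨾ ifEq (get #found) (num 1) merge nop

-- The n + 1 rounds are more than enough; once a single vertex survives, the search fails and the
-- remaining rounds merge nothing.
eliminateAll : Stmt 4
eliminateAll = for #step eliminate

countMatchings : Stmt 4
countMatchings = initialise ⨾ eliminateAll ⨾ set #N (#poly at num 0)

-- Stated for a variable m: a bound of the form suc _ would unroll the loops
-- during type checking.
countMatchings-output : ∀ m σ →
  nvar (exec m countMatchings σ) #N ≡ narr (exec m eliminateAll (exec m initialise σ)) #poly 0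
countMatchings-output m σ = refl

-- Index arithmetic

block-< : ∀ m {i j k l} → i < j → k < m → m * i + k < m * j + l
block-< m {i} {j} {k} {l} i<j k<m = begin-strict
  m * i + k    <⟨ +-monoʳ-< (m * i) k<m ⟩
  m * i + m    ≡⟨ +-comm (m * i) m ⟩
  m + m * i    ≡⟨ *-suc m i ⟨
  m * suc i    ≤⟨ *-monoʳ-≤ m i<j ⟩
  m * j        ≤⟨ m≤m+n (m * j) l ⟩
  m * j + l    ∎
  where open ≤-Reasoning

-- Only the inner index has to be a base-m digit, so the statement can be applied twice to m(ma + b)
-- + k.
block-injective : ∀ m {i j k l} → k < m → l < m → m * i + k ≡ m * j + l → i ≡ j × k ≡ l
block-injective m {i} {j} {k} {l} k<m l<m e with <-cmp i j
... | tri< i<j _ _ = ⊥-elim (<-irrefl e (block-< m i<j k<m))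
... | tri> _ _ j<i = ⊥-elim (<-irrefl (sym e) (block-< m j<i l<m))
... | tri≈ _ refl _ = refl , +-cancelˡ-≡ (m * i) k l e

module Run (m : ℕ) where

  -- The table of crossing numbers

  module Table (c : Bool) where

    index : ℕ → ℕ → ℕ → ℕ
    index a b k = m * (m * a + b) + k

    -- The table is filled in increasing order of index, so a single bound q serves as invariant for
    -- all three nested loops.
    record Filled (q : ℕ) (t : ℕ → ℕ) : Set where
      constructor filled-by
      field
        entries : ∀ {a b k} → a < m → b < m → k < m → index a b k < q →
                  t (index a b k) ≡ crossing c a b k

    open Filled

    index-cong : ∀ {m′ a a′ b b′ k k′} → m′ ≡ m → a′ ≡ a → b′ ≡ b → k′ ≡ k →
                 m′ * (m′ * a′ + b′) + k′ ≡ index a b k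
    index-cong refl refl refl refl = refl

    crossing-cong : ∀ {a a′ b b′ k k′} → a ≡ a′ × b ≡ b′ → k ≡ k′ →
                    crossing c a b k ≡ crossing c a′ b′ k′
    crossing-cong (refl , refl) refl = refl

    Filled-put : ∀ {a b k τ σ i v} → a < m → b < m → k < m → Filled (index a b k) (narr τ #table) →
      narr σ #table ≡ narr τ #table → i ≡ index a b k → v ≡ crossing c a b k →
      Filled (suc (index a b k)) (narr (setA #table i v σ) #table)
    entries (Filled-put {a} {b} {k} {τ} {σ} {i} {v} a<m b<m k<m filled σ≡ refl v≡) {a′} {b′} {k′} a′< b′< k′< l
      with index a′ b′ k′ ℕ.≟ index a b k
    ... | no ne rewrite σ≡ = entries filled a′< b′< k′< (≤∧≢⇒< (s≤s⁻¹ l) ne)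
    ... | yes e with ab≡ , k≡ ← block-injective m k′< k<m e =
      trans v≡ (sym (crossing-cong (block-injective m b′< b<m ab≡) k≡))

    tableEntry-fills : ∀ {a b k τ} → nvar τ #M ≡ m → nvar τ #c ≡ 𝟙 c →
      nvar τ #a ≡ a → nvar τ #b ≡ b → nvar τ #k ≡ k → a < m → b < m → k < m →
      Filled (index a b k) (narr τ #table) → Filled (suc (index a b k)) (narr (exec m tableEntry τ) #table)
    tableEntry-fills {zero} {b} {k} {τ} M≡ c≡ a≡ b≡ k≡ a<m b<m k<m filled =
      wp-sound m tableEntry {λ τ → Filled _ (narr τ #table)} τ
        ( (λ _ → (λ b≡k → put-here (sym (cong 𝟙 (≡ᵇ-true (trans (sym b≡) (trans b≡k k≡))))))
               , (λ b≢k → put-here (sym (cong 𝟙 (≡ᵇ-false λ e → b≢k (trans b≡ (trans e (sym k≡)))))))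
          )
        , (λ a≢0 → ⊥-elim (a≢0 a≡)) )
      where
      put-here : ∀ {v} → v ≡ crossing c zero b k → Filled (suc (index zero b k))
                 (narr (setA #table (eval (tableIndex #a #b #k) τ) v τ) #table)
      put-here = Filled-put {τ = τ} {σ = τ} a<m b<m k<m filled refl (index-cong M≡ a≡ b≡ k≡)
      ≡ᵇ-true : b ≡ k → (b ≡ᵇ k) ≡ true
      ≡ᵇ-true refl with b ≡ᵇ b | ≡⇒≡ᵇ b b refl
      ... | true | _ = refl
      ≡ᵇ-false : b ≢ k → (b ≡ᵇ k) ≡ false
      ≡ᵇ-false ne with b ≡ᵇ k | ≡ᵇ⇒≡ b k
      ... | false | _ = refl
      ... | true  | h = ⊥-elim (ne (h _))
    tableEntry-fills {suc a} {b} {k} {τ} M≡ c≡ a≡ b≡ k≡ a<m b<m k<m filled =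
      wp-sound m tableEntry {λ τ → Filled _ (narr τ #table)} τ
        ( (λ a≡0 → ⊥-elim (1+n≢0 (trans (sym a≡) a≡0)))
        , (λ _ → (λ k≡0 → entry 0 (cong (shift (crossing c a b)) (trans (sym k≡0) k≡)))
               , (λ k≢0 → entry _ (shifted k k≡ k<m (λ e → k≢0 (trans k≡ e)))))
        )
      where
      -- The block of a precedes the block of a + 1 entirely, so it is filled for all b′ and k′.
      earlier : ∀ {b′ k′} → b′ < m → k′ < m → narr τ #table (index a b′ k′) ≡ crossing c a b′ k′
      earlier b′< k′< = entries filled (<⇒≤ a<m) b′< k′<
        (block-< m (block-< m (n<1+n a) b′<) k′<)
      a⁻≡ : pred (nvar τ #a) ≡ a
      a⁻≡ = cong pred a≡
      read : ∀ {b′ k′ x y} → b′ < m → k′ < m → x ≡ b′ → y ≡ k′ →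
        narr τ #table (nvar τ #M * (nvar τ #M * pred (nvar τ #a) + x) + y) ≡ crossing c a b′ k′
      read b′< k′< x≡ y≡ = trans (cong (narr τ #table) (index-cong M≡ a⁻≡ x≡ y≡)) (earlier b′< k′<)
      shifted : ∀ k → nvar τ #k ≡ k → k < m → k ≢ 0 →
        narr τ #table (nvar τ #M * (nvar τ #M * pred (nvar τ #a) + nvar τ #b) + pred (nvar τ #k)) ≡
        shift (crossing c a b) k
      shifted zero    _  _   k≢0 = ⊥-elim (k≢0 refl)
      shifted (suc k) k≡ k<m _   = read b<m (<⇒≤ k<m) b≡ (cong pred k≡)
      τ⁻ : Store
      τ⁻ = setN #k⁻ (pred (nvar τ #k)) (setN #b⁻ (pred (nvar τ #b)) (setN #a⁻ (pred (nvar τ #a)) τ))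
      entry : ∀ x → x ≡ shift (crossing c a b) k → Filled (suc (index (suc a) b k))
        (narr (exec m {0} (put #table (tableIndex #a #b #k)
          (get #prev ⊞ get #c ⊠ (get #b ⊠ #table at tableIndex #a⁻ #b⁻ #k))) (setN #prev x τ⁻)) #table)
      entry x x≡ = Filled-put {τ = τ} {σ = setN #prev x τ⁻} a<m b<m k<m filled refl (index-cong M≡ a≡ b≡ k≡)
        (cong₂ _+_ x≡ (cong₂ _*_ c≡ (cong₂ _*_ b≡
          (read (≤-<-trans pred[n]≤n b<m) k<m (cong pred b≡) k≡))))

    fillTable-correct : ∀ σ → nvar σ #M ≡ m → nvar σ #c ≡ 𝟙 c →
      ∀ {a b k} → a < m → b < m → k < m →
      narr (exec m fillTable σ) #table (index a b k) ≡ crossing c a b k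
    fillTable-correct σ M≡ c≡ {a} {b} {k} a<m b<m k<m =
      entries rows a<m b<m k<m (<-≤-trans (block-< m (block-< m a<m b<m) k<m)
        (≤-reflexive (trans (+-identityʳ _) (cong (m *_) (+-identityʳ _)))))
      where
      castFilled : ∀ {q q′ t} → q ≡ q′ → Filled q t → Filled q′ t
      castFilled refl f = f
      forK : Stmt 1
      forK = for #k tableEntry
      forB : Stmt 2
      forB = for #b forK
      rows : Filled (m * (m * m)) (narr (exec m fillTable σ) #table)
      rows = exec-for m #a forB σ (λ a τ → Filled (m * (m * a)) (narr τ #table))
        (filled-by λ {a} {b} {k} _ _ _ l → ⊥-elim (n≮0 (subst (index a b k <_)
          (trans (cong (m *_) (*-zeroʳ m)) (*-zeroʳ m)) l)))
        λ a τ a<m a≡ ch f →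
          let castEnd = trans (+-comm (m * a) m) (sym (*-suc m a)) in
          castFilled (cong (m *_) castEnd)
            (exec-for m #b forK τ (λ b τ → Filled (m * (m * a + b)) (narr τ #table))
              (castFilled (cong (m *_) (sym (+-identityʳ (m * a)))) f)
              λ b τ′ b<m b≡ ch′ f′ →
                castFilled (trans (+-comm (m * (m * a + b)) m)
                    (trans (sym (*-suc m (m * a + b))) (cong (m *_) (sym (+-suc (m * a) b)))))
                  (exec-for m #k tableEntry τ′ (λ k τ → Filled (m * (m * a + b) + k) (narr τ #table))
                    (castFilled (sym (+-identityʳ (m * (m * a + b)))) f′)
                    λ k τ″ k<m k≡ ch″ f″ →
                      castFilled (sym (+-suc (m * (m * a + b)) k))
                        (tableEntry-fills {τ = τ″}
                          (trans (vars ch″ #M) (trans (vars ch′ #M) (trans (vars ch #M) M≡)))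
                          (trans (vars ch″ #c) (trans (vars ch′ #c) (trans (vars ch #c) c≡)))
                          (trans (vars ch″ #a) (trans (vars ch′ #a) a≡))
                          (trans (vars ch″ #b) b≡) k≡ a<m b<m k<m f″)))

  -- Multiplication of the polynomials of two vertices

  module Multiply (c : Bool) (P Q : ℕ → ℕ) where

    open Table c using (index; fillTable-correct)

    -- Indices mention the stored `nvar τ #M` rather than m, which is the form in which the
    -- program's terms evaluate.
    record Operands (τ : Store) : Set where
      field
        M≡    : nvar τ #M ≡ m
        left  : ∀ a → a < m → narr τ #poly (nvar τ #M * nvar τ #fu + a) ≡ P a
        right : ∀ b → b < m → narr τ #poly (nvar τ #M * nvar τ #fv + b) ≡ Q b
        cells : ∀ {a b k} → a < m → b < m → k < m →
                narr τ #table (nvar τ #M * (nvar τ #M * a + b) + k) ≡ crossing c a b k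

    open Operands

    operands-unchanged : ∀ {d} {p : Stmt d} {σ τ} {_ : Untouched #M p} {_ : Untouched #fu p}
      {_ : Untouched #fv p} {_ : UntouchedArray #poly p} {_ : UntouchedArray #table p} →
      Unchanged p σ τ → Operands σ → Operands τ
    operands-unchanged {p = p} {σ} {τ} {uM} {uFu} {uFv} {uP} {uT} ch o = record
      { M≡    = trans M₌ (M≡ o)
      ; left  = λ a a< → trans (cong₂ (λ f i → f (i + a)) P₌ (cong₂ _*_ M₌ fu₌)) (left o a a<)
      ; right = λ b b< → trans (cong₂ (λ f i → f (i + b)) P₌ (cong₂ _*_ M₌ fv₌)) (right o b b<)
      ; cells = λ {a} {b} {k} a< b< k< →
          trans (cong₂ (λ f i → f (i * (i * a + b) + k)) T₌ M₌) (cells o a< b< k<) }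
      where
      M₌  = vars ch #M {uM}
      fu₌ = vars ch #fu {uFu}
      fv₌ = vars ch #fv {uFv}
      P₌  = arrays ch #poly {uP}
      T₌  = arrays ch #table {uT}

    rowStep : Stmt 0
    rowStep = set #row ((#poly at polyIndex #fv #b) ⊠ (#table at tableIndex #a #b #k) ⊞ get #row)

    forB : Stmt 1
    forB = for #b rowStep

    row-correct : ∀ {a k} τ → Operands τ → nvar τ #a ≡ a → nvar τ #k ≡ k → a < m → k < m →
      nvar τ #row ≡ 0 → nvar (exec m forB τ) #row ≡ crossingRow c m Q a k
    row-correct {a} {k} τ o a≡ k≡ a<m k<m row≡ =
      exec-for m #b rowStep τ (λ i τ → nvar τ #row ≡ ∑ (downFrom i) λ b → Q b * crossing c a b k) row≡
        λ b τ′ b<m b≡ ch ih → let o′ = operands-unchanged ch o in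
          cong₂ _+_ (cong₂ _*_
            (trans (cong (λ z → narr τ′ #poly (nvar τ′ #M * nvar τ′ #fv + z)) b≡) (right o′ b b<m))
            (trans (cell τ′ (trans (vars ch #a) a≡) b≡ (trans (vars ch #k) k≡)) (cells o′ a<m b<m k<m)))
            ih
      where
      cell : ∀ τ {a b k x y z} → x ≡ a → y ≡ b → z ≡ k →
        narr τ #table (nvar τ #M * (nvar τ #M * x + y) + z) ≡
        narr τ #table (nvar τ #M * (nvar τ #M * a + b) + k)
      cell τ refl refl refl = refl

    sumStep : Stmt 1
    sumStep = set #row (num 0) ⨾ forB ⨾ set #acc ((#poly at polyIndex #fu #a) ⊠ get #row ⊞ get #acc)

    forA : Stmt 2
    forA = for #a sumStep

    sum-correct : ∀ {k} τ → Operands τ → nvar τ #k ≡ k → k < m → nvar τ #acc ≡ 0 →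
      nvar (exec m forA τ) #acc ≡ crossingProduct c m P Q k
    sum-correct {k} τ o k≡ k<m acc≡ =
      exec-for m #a sumStep τ (λ i τ → nvar τ #acc ≡ ∑ (downFrom i) λ a → P a * crossingRow c m Q a k) acc≡
        λ a τ′ a<m a≡ ch ih →
          let τ₀  = setN #row 0 τ′
              o₀  = operands-unchanged {p = set {0} #row (num 0)} (exec-unchanged m (set {0} #row (num 0)) τ′)
                      (operands-unchanged ch o)
              τ₁  = exec m forB τ₀
              ch₁ = exec-unchanged m forB τ₀
              o₁  = operands-unchanged ch₁ o₀
          in cong₂ _+_ (cong₂ _*_
               (trans (cong (λ z → narr τ₁ #poly (nvar τ₁ #M * nvar τ₁ #fu + z)) (trans (vars ch₁ #a) a≡))
                      (left o₁ a a<m))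
               (row-correct τ₀ o₀ a≡ (trans (vars ch #k) k≡) a<m k<m refl))
               (trans (vars ch₁ #acc) ih)

    entryStep : Stmt 2
    entryStep = set #acc (num 0) ⨾ forA ⨾ put #result (get #k) (get #acc)

    multiply-correct : ∀ σ → Operands σ → ∀ {k} → k < m →
      narr (exec m multiply σ) #result k ≡ crossingProduct c m P Q k
    multiply-correct σ o = exec-for m #k entryStep σ
      (λ i τ → ∀ {k} → k < i → narr τ #result k ≡ crossingProduct c m P Q k) (λ ())
      λ i τ i<m i≡ ch ih {k} k≤i →
        let τ₀  = setN #acc 0 τ
            o₀  = operands-unchanged {p = set {0} #acc (num 0)} (exec-unchanged m (set {0} #acc (num 0)) τ)
                    (operands-unchanged ch o)
            ch₁ = exec-unchanged m forA τ₀
        in put-result (exec m forA τ₀) (trans (vars ch₁ #k) i≡) (sum-correct τ₀ o₀ i≡ i<m refl)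
             (λ k< → trans (cong (λ f → f _) (arrays ch₁ #result)) (ih k<)) k≤i
      where
      put-result : ∀ {i} τ → nvar τ #k ≡ i → nvar τ #acc ≡ crossingProduct c m P Q i →
        (∀ {k} → k < i → narr τ #result k ≡ crossingProduct c m P Q k) →
        ∀ {k} → k < suc i →
        narr (exec m {0} (put #result (get #k) (get #acc)) τ) #result k ≡ crossingProduct c m P Q k
      put-result τ refl acc≡ old {k} k≤i with k ℕ.≟ nvar τ #k
      ... | yes refl = acc≡
      ... | no ne    = old (≤∧≢⇒< (s≤s⁻¹ k≤i) ne)

  -- Writing the product back and merging two vertices

  record Copied (u : ℕ) (σ τ : Store) (i : ℕ) : Set where
    field
      copied : ∀ {k} → k < i → narr τ #poly (m * u + k) ≡ narr σ #result k
      others : ∀ {w k} → w ≢ u → k < m → narr τ #poly (m * w + k) ≡ narr σ #poly (m * w + k)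

  copy-correct : ∀ u σ → nvar σ #M ≡ m → nvar σ #fu ≡ u → Copied u σ (exec m copy σ) m
  copy-correct u σ M≡ fu≡ = exec-for m #k body σ (λ i τ → Copied u σ τ i)
    (record { copied = λ () ; others = λ _ _ → refl })
    λ i τ i<m i≡ ch ih → step τ i<m
      (trans (cong₂ _+_ (cong₂ _*_ (trans (vars ch #M) M≡) (trans (vars ch #fu) fu≡)) i≡) refl)
      (trans (cong₂ (λ f k → f k) (arrays ch #result) i≡) refl) ih
    where
    body : Stmt 2
    body = put #poly (polyIndex #fu #k) (#result at get #k)
    step : ∀ {i} τ {j r} → i < m → j ≡ m * u + i → r ≡ narr σ #result i →
      Copied u σ τ i → Copied u σ (setN #k (suc i) (setA #poly j r τ)) (suc i)
    step {i} τ {j} {r} i<m refl r≡ ih = record { copied = copied′ ; others = others′ }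
      where
      copied′ : ∀ {k} → k < suc i → narr (setA #poly j r τ) #poly (m * u + k) ≡ narr σ #result k
      copied′ {k} k≤i with m * u + k ℕ.≟ m * u + i
      ... | yes e = trans r≡ (cong (narr σ #result) (sym (+-cancelˡ-≡ (m * u) k i e)))
      ... | no ne = Copied.copied ih (≤∧≢⇒< (s≤s⁻¹ k≤i) λ e → ne (cong (λ z → m * u + z) e))
      others′ : ∀ {w k} → w ≢ u → k < m →
        narr (setA #poly j r τ) #poly (m * w + k) ≡ narr σ #poly (m * w + k)
      others′ {w} {k} w≢u k<m = trans
        (update-other (narr τ #poly) r λ e → w≢u (proj₁ (block-injective m k<m i<m e)))
        (Copied.others ih w≢u k<m)

  record Merged (c : Bool) (u v : ℕ) (P Q : ℕ → ℕ) (σ τ : Store) : Set where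
    field
      product   : ∀ {k} → k < m → narr τ #poly (m * u + k) ≡ crossingProduct c m P Q k
      others    : ∀ {w k} → w ≢ u → k < m → narr τ #poly (m * w + k) ≡ narr σ #poly (m * w + k)
      killed    : narr τ #alive v ≡ 0
      surviving : ∀ {w} → w ≢ v → narr τ #alive w ≡ narr σ #alive w

  merge-correct : ∀ {c u v P Q} σ → nvar σ #M ≡ m → nvar σ #fu ≡ u → nvar σ #fv ≡ v →
    eval (adjAt #fu #fv) σ ≡ 𝟙 c →
    (∀ a → a < m → narr σ #poly (m * u + a) ≡ P a) →
    (∀ b → b < m → narr σ #poly (m * v + b) ≡ Q b) →
    Merged c u v P Q σ (exec m merge σ)
  merge-correct {c} {u} {v} {P} {Q} σ M≡ fu≡ fv≡ c≡ left right = record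
    { product   = λ k< → trans (Copied.copied copied k<)
                    (Multiply.multiply-correct c P Q σ₂ operands k<)
    ; others    = λ {w} {k} w≢u k< → trans (Copied.others copied w≢u k<)
                    (cong (λ f → f (m * w + k)) poly₌)
    ; killed    = trans (cong (λ z → narr (setA #alive z 0 σ₄) #alive v) fv₄)
                    (update-same (narr σ₄ #alive) v 0)
    ; surviving = λ {w} w≢v → trans (update-other (narr σ₄ #alive) 0 (λ e → w≢v (trans e fv₄)))
                    (cong (λ f → f w) alive₌)
    }
    where
    σ₁ = setN #c (eval (adjAt #fu #fv) σ) σ
    σ₂ = exec m fillTable σ₁
    σ₃ = exec m multiply σ₂
    σ₄ = exec m copy σ₃
    ch₂ = exec-unchanged m fillTable σ₁
    ch₃ = exec-unchanged m multiply σ₂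
    ch₄ = exec-unchanged m copy σ₃
    M₂ = trans (vars ch₂ #M) M≡
    fu₂ = trans (vars ch₂ #fu) fu≡
    fv₂ = trans (vars ch₂ #fv) fv≡
    fv₄ = trans (vars ch₄ #fv) (trans (vars ch₃ #fv) fv₂)
    poly₌ = trans (arrays ch₃ #poly) (arrays ch₂ #poly)
    alive₌ = trans (arrays ch₄ #alive) (trans (arrays ch₃ #alive) (arrays ch₂ #alive))
    operands : Multiply.Operands c P Q σ₂
    operands = record
      { M≡    = M₂
      ; left  = λ a a< → trans (cong₂ (λ f i → f (i + a)) (arrays ch₂ #poly) (cong₂ _*_ M₂ fu₂)) (left a a<)
      ; right = λ b b< → trans (cong₂ (λ f i → f (i + b)) (arrays ch₂ #poly) (cong₂ _*_ M₂ fv₂)) (right b b<)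
      ; cells = λ {a} {b} {k} a< b< k< →
          trans (cong (λ z → narr σ₂ #table (z * (z * a + b) + k)) M₂)
            (Table.fillTable-correct c σ₁ M≡ c≡ a< b< k<) }
    copied = copy-correct u σ₃ (trans (vars ch₃ #M) M₂) (trans (vars ch₃ #fu) fu₂)

  -- The search for twins

  module Search (N : ℕ) (A K : ℕ → ℕ) where

    Agree : ℕ → ℕ → ℕ → Set
    Agree u v w = K w ≡ 1 → w ≢ u → w ≢ v → A (N * u + w) ≡ A (N * v + w)

    TwinsAt : ℕ → ℕ → Set
    TwinsAt u v = K u ≡ 1 × K v ≡ 1 × v ≢ 0 × u ≢ v × (∀ w → w < m → Agree u v w)

    record Context (τ : Store) : Set where
      field
        N≡ : nvar τ #N ≡ N
        A≡ : narr τ #adj ≡ A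
        K≡ : narr τ #alive ≡ K

      alive≡ : ∀ {x y} → x ≡ y → narr τ #alive x ≡ K y
      alive≡ = cong₂ (λ f i → f i) K≡

      adj≡ : ∀ {x x′ y y′} → x ≡ x′ → y ≡ y′ → narr τ #adj (nvar τ #N * x + y) ≡ A (N * x′ + y′)
      adj≡ refl refl = cong₂ (λ f n → f (n * _ + _)) A≡ N≡

    open Context

    context-unchanged : ∀ {d} {p : Stmt d} {σ τ} {_ : Untouched #N p} {_ : UntouchedArray #adj p}
      {_ : UntouchedArray #alive p} → Unchanged p σ τ → Context σ → Context τ
    context-unchanged {_} {_} {_} {_} {uN} {uA} {uK} ch c = record
      { N≡ = trans (vars ch #N {uN}) (N≡ c)
      ; A≡ = trans (arrays ch #adj {uA}) (A≡ c)
      ; K≡ = trans (arrays ch #alive {uK}) (K≡ c) }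

    -- A cleared flag must carry a refutation, since an unsuccessful search has to prove that no
    -- twins exist.
    data Verdict (Q : Set) (ok : ℕ) : Set where
      holds : ok ≡ 1 → Q → Verdict Q ok
      fails : ok ≡ 0 → ¬ Q → Verdict Q ok

    Below : (ℕ → Set) → ℕ → Set
    Below R i = ∀ w → w < i → R w

    checkVertex-correct : ∀ {u v w} τ → Context τ → nvar τ #u ≡ u → nvar τ #v ≡ v → nvar τ #w ≡ w →
      Verdict (Below (Agree u v) w) (nvar τ #ok) →
      Verdict (Below (Agree u v) (suc w)) (nvar (exec m checkVertex τ) #ok)
    checkVertex-correct {u} {v} {w} τ c u≡ v≡ w≡ verdict =
      wp-sound m checkVertex {λ τ → Verdict (Below (Agree u v) (suc w)) (nvar τ #ok)} τ
        ( (λ w-alive →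
            (λ w=u → agree λ _ w≢u _ → ⊥-elim (w≢u (trans (sym w≡) (trans w=u u≡)))) , λ w≢u →
            (λ w=v → agree λ _ _ w≢v → ⊥-elim (w≢v (trans (sym w≡) (trans w=v v≡)))) , λ w≢v →
            (λ same → agree λ _ _ _ → trans (sym (adj≡ c u≡ w≡)) (trans same (adj≡ c v≡ w≡))) ,
            (λ differ → fails refl λ all → differ (trans (adj≡ c u≡ w≡)
               (trans (all w ≤-refl (trans (sym (alive≡ c w≡)) w-alive)
                 (λ e → w≢u (trans w≡ (trans e (sym u≡)))) (λ e → w≢v (trans w≡ (trans e (sym v≡)))))
               (sym (adj≡ c v≡ w≡))))))
        , (λ dead → agree λ alive _ _ → ⊥-elim (dead (trans (alive≡ c w≡) alive))))
      where
      extend : ∀ {x} → Agree u v w → Verdict (Below (Agree u v) w) x → Verdict (Below (Agree u v) (suc w)) x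
      extend a (fails ok≡ ¬all) = fails ok≡ λ all → ¬all λ w l → all w (m≤n⇒m≤1+n l)
      extend a (holds ok≡ all)  = holds ok≡ extended
        where
        extended : Below (Agree u v) (suc w)
        extended w′ l with m≤n⇒m<n∨m≡n (s≤s⁻¹ l)
        ... | inj₁ w′<w = all w′ w′<w
        ... | inj₂ refl = a
      agree : Agree u v w → Verdict (Below (Agree u v) (suc w)) (nvar τ #ok)
      agree a = extend a verdict

    -- `Done` describes the pairs visited so far; it matters only while nothing has been found, as a
    -- recorded pair of twins stays valid.
    data Outcome (Done : ℕ → ℕ → Set) (τ : Store) : Set where
      found   : nvar τ #found ≡ 1 → nvar τ #fu < m → nvar τ #fv < m →
                TwinsAt (nvar τ #fu) (nvar τ #fv) → Outcome Done τ
      missing : nvar τ #found ≡ 0 → (∀ u v → Done u v → ¬ TwinsAt u v) → Outcome Done τ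

    outcome-cong : ∀ {D D′ σ τ} → nvar τ #found ≡ nvar σ #found → nvar τ #fu ≡ nvar σ #fu →
      nvar τ #fv ≡ nvar σ #fv → (∀ u v → D′ u v → D u v) → Outcome D σ → Outcome D′ τ
    outcome-cong {σ = σ} {τ} f≡ fu≡ fv≡ sub (found f fu< fv< t) = found (trans f≡ f)
      (subst (_< m) (sym fu≡) fu<) (subst (_< m) (sym fv≡) fv<) (subst₂ TwinsAt (sym fu≡) (sym fv≡) t)
    outcome-cong f≡ _ _ sub (missing f none) = missing (trans f≡ f) λ u v d → none u v (sub u v d)

    -- The hypothesis on `D` and `D′` lets at most the current pair join the visited ones, which
    -- keeps the order of the double loop out of this argument.
    checkPair-correct : ∀ {u v D D′} τ → Context τ → nvar τ #u ≡ u → nvar τ #v ≡ v → u < m → v < m →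
      (∀ u′ v′ → D′ u′ v′ → D u′ v′ ⊎ (u′ ≡ u × v′ ≡ v)) →
      Outcome D τ → Outcome D′ (exec m checkPair τ)
    checkPair-correct {u} {v} {D} {D′} τ c u≡ v≡ u<m v<m grow outcome =
      wp-sound m checkPair {Outcome D′} τ
        ( (λ u-alive →
            (λ v-alive →
              (λ v=0 → miss λ { (_ , _ , v≢0 , _) → v≢0 (trans (sym v≡) v=0) }) , λ v≢0 →
              (λ u=v → miss λ { (_ , _ , _ , u≢v , _) → u≢v (trans (sym u≡) (trans u=v v≡)) }) , λ u≢v →
              conclude (trans (sym (alive≡ c u≡)) u-alive) (trans (sym (alive≡ c v≡)) v-alive)
                (λ e → v≢0 (trans v≡ e)) (λ e → u≢v (trans u≡ (trans e (sym v≡)))) verdict)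
            , (λ v-dead → miss λ { (_ , v-alive , _) → v-dead (trans (alive≡ c v≡) v-alive) }))
        , (λ u-dead → miss λ { (u-alive , _) → u-dead (trans (alive≡ c u≡) u-alive) }))
      where
      τ₀ = setN #ok 1 τ
      τ₁ = exec m (for {0} #w checkVertex) τ₀
      ch₁ = exec-unchanged m (for {0} #w checkVertex) τ₀
      verdict : Verdict (Below (Agree u v) m) (nvar τ₁ #ok)
      verdict = exec-for m #w checkVertex τ₀ (λ i τ → Verdict (Below (Agree u v) i) (nvar τ #ok))
        (holds refl λ _ ())
        λ i τ′ i<m i≡ ch → checkVertex-correct τ′ (context-unchanged ch (context-unchanged
          (exec-unchanged m (set {0} #ok (num 1)) τ) c))
          (trans (vars ch #u) u≡) (trans (vars ch #v) v≡) i≡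
      extend : ¬ TwinsAt u v → ∀ {τ} → Outcome D τ → Outcome D′ τ
      extend ¬t (found f fu< fv< t) = found f fu< fv< t
      extend ¬t (missing f none)    = missing f none′
        where
        none′ : ∀ u v → D′ u v → ¬ TwinsAt u v
        none′ u′ v′ d with grow u′ v′ d
        ... | inj₁ d′ = none u′ v′ d′
        ... | inj₂ (refl , refl) = ¬t
      miss : ¬ TwinsAt u v → Outcome D′ τ
      miss ¬t = extend ¬t outcome
      miss₁ : ¬ TwinsAt u v → Outcome D′ τ₁
      miss₁ ¬t = outcome-cong (vars ch₁ #found) (vars ch₁ #fu) (vars ch₁ #fv) (λ _ _ d → d) (miss ¬t)
      conclude : K u ≡ 1 → K v ≡ 1 → v ≢ 0 → u ≢ v → Verdict (Below (Agree u v) m) (nvar τ₁ #ok) →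
        wp m (ifEq {1} (get #ok) (num 1) (set #found (num 1) ⨾ set #fu (get #u) ⨾ set #fv (get #v)) nop)
          (Outcome D′) τ₁
      conclude Ku Kv v≢0 u≢v (holds ok≡ all) =
        (λ _ → found refl (subst (_< m) (sym u₁) u<m) (subst (_< m) (sym v₁) v<m)
          (subst₂ TwinsAt (sym u₁) (sym v₁) (Ku , Kv , v≢0 , u≢v , all)))
        , (λ ne → ⊥-elim (ne ok≡))
        where
        u₁ = trans (vars ch₁ #u) u≡
        v₁ = trans (vars ch₁ #v) v≡
      conclude Ku Kv v≢0 u≢v (fails ok≡ ¬all) =
        (λ e → ⊥-elim (1+n≢0 (trans (sym e) ok≡)))
        , (λ _ → miss₁ λ { (_ , _ , _ , _ , all) → ¬all all })

    search-correct : ∀ σ → Context σ → Outcome (λ u v → u < m × v < m) (exec m search σ)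
    search-correct σ c = exec-for m #u forV (setN #found 0 σ) (λ i τ → Outcome (λ u v → u < i × v < m) τ)
      (missing refl λ { _ _ (() , _) })
      λ i τ i<m i≡ ch o →
        let c₁ = context-unchanged ch (context-unchanged (exec-unchanged m (set {0} #found (num 0)) σ) c) in
        outcome-cong refl refl refl (λ { u v (u< , v<) → finish i u v (m≤n⇒m<n∨m≡n (s≤s⁻¹ u<)) v< })
          (exec-for m #v checkPair τ (λ j τ → Outcome (Visited i j) τ)
            (outcome-cong refl refl refl (λ { u v (inj₁ d) → d ; u v (inj₂ (_ , ())) }) o)
            λ j τ′ j<m j≡ ch′ o′ → outcome-cong refl refl refl (λ _ _ d → d)
              (checkPair-correct {D′ = Visited i (suc j)} τ′ (context-unchanged ch′ c₁)
                (trans (vars ch′ #u) i≡) j≡ i<m j<m (grow i j) o′))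
      where
      forV : Stmt 2
      forV = for #v checkPair
      Visited : ℕ → ℕ → ℕ → ℕ → Set
      Visited i j u v = (u < i × v < m) ⊎ (u ≡ i × v < j)
      grow : ∀ i j u v → Visited i (suc j) u v → Visited i j u v ⊎ (u ≡ i × v ≡ j)
      grow i j u v (inj₁ d) = inj₁ (inj₁ d)
      grow i j u v (inj₂ (e , l)) with m≤n⇒m<n∨m≡n (s≤s⁻¹ l)
      ... | inj₁ v<j = inj₁ (inj₂ (e , v<j))
      ... | inj₂ v≡j = inj₂ (e , v≡j)
      finish : ∀ i u v → u < i ⊎ u ≡ i → v < m → Visited i m u v
      finish i u v (inj₁ u<i) v<m = inj₁ (u<i , v<m)
      finish i u v (inj₂ u≡i) v<m = inj₂ (u≡i , v<m)

-- Correctness of the elimination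

𝟙-injective : ∀ {a b} → 𝟙 a ≡ 𝟙 b → a ≡ b
𝟙-injective {true}  {true}  _ = refl
𝟙-injective {false} {false} _ = refl

⌊⌋-witness : {A : Set} (a? : Dec A) → ⌊ a? ⌋ ≡ true → A
⌊⌋-witness (yes a) _ = a

∑-mono-≤ : {A : Set} (xs : List A) {f g : A → ℕ} → (∀ x → f x ≤ g x) → ∑ xs f ≤ ∑ xs g
∑-mono-≤ []       h = z≤n
∑-mono-≤ (x ∷ xs) h = +-mono-≤ (h x) (∑-mono-≤ xs h)

∑-mono-< : {A : Set} {xs : List A} {f g : A → ℕ} → (∀ x → f x ≤ g x) →
           ∀ {x} → x ∈ xs → f x < g x → ∑ xs f < ∑ xs g
∑-mono-< {xs = x ∷ xs} h (here refl) l = +-mono-<-≤ l (∑-mono-≤ xs h)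
∑-mono-< {xs = x ∷ xs} h (there m)   l = +-mono-≤-< (h x) (∑-mono-< h m l)

∑-one : {A : Set} (xs : List A) → ∑ xs (λ _ → 1) ≡ length xs
∑-one []       = refl
∑-one (x ∷ xs) = cong suc (∑-one xs)

-- The input

adjacency : ∀ {n} → Graph (Fin n) → ℕ → ℕ
adjacency G i = ∣ adjacencyArray G (+ i) ∣

adjacency-pos : ∀ {n} (G : Graph (Fin n)) i → adjacencyArray G (+ i) ≡ + adjacency G i
adjacency-pos {n} G i with i ℕ.<? n * n
... | no _  = refl
... | yes l with uncurry (adj G) (remQuot {n} n (fromℕ< l))
...   | true  = refl
...   | false = refl

adjacency-correct : ∀ {n} (G : Graph (Fin n)) u v → adjacency G (n * toℕ u + toℕ v) ≡ 𝟙 (adj G u v)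
adjacency-correct {n} G u v with n * toℕ u + toℕ v ℕ.<? n * n
... | no ≮ = ⊥-elim (≮ (subst (_< n * n) (toℕ-combine u v) (toℕ<n (combine u v))))
... | yes l = trans (cong (λ e → ∣ if uncurry (adj G) e then + 1 else + 0 ∣) position) (value (adj G u v))
  where
  position : remQuot {n} n (fromℕ< l) ≡ (u , v)
  position = trans (cong (remQuot n) (toℕ-injective (trans (toℕ-fromℕ< l) (sym (toℕ-combine u v)))))
                   (remQuot-combine u v)
  value : ∀ b → ∣ if b then + 1 else + 0 ∣ ≡ 𝟙 b
  value true  = refl
  value false = refl

-- Describes the memory after the first instruction of `cographProgram`, which puts n + 1 into
-- variable 1.
inputStore : ∀ {n} → Graph (Fin n) → Store
inputStore {n} G = store v a
  where
  v : ℕ → ℕ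
  v zero          = n
  v (suc zero)    = suc n
  v (suc (suc _)) = 0
  a : ℕ → ℕ → ℕ
  a zero    = adjacency G
  a (suc _) = λ _ → 0

-- m is kept abstract because a bound of the form suc _ would unroll the loops
-- during type checking.
module Elimination {n : ℕ} (G : Graph (Fin n)) (cograph : Cograph G)
  (origin : Fin n) (origin≡0 : toℕ origin ≡ 0) (m : ℕ) (m≡ : m ≡ suc n) where

  private
    V : Set
    V = Fin n

  <m⇒≤n : ∀ {w} → w < m → w ≤ n
  <m⇒≤n {w} w<m = s≤s⁻¹ (subst (w <_) m≡ w<m)

  vertex<m : ∀ (v : V) → toℕ v < m
  vertex<m v = subst (toℕ v <_) (sym m≡) (m≤n⇒m≤1+n (toℕ<n v))

  ≡origin : ∀ {v} → toℕ v ≡ 0 → v ≡ origin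
  ≡origin e = toℕ-injective (trans e (sym origin≡0))

  open Matchings _≟_ G
  open Run m

  -- The invariant of the elimination and its preservation by a merge

  class : (V → V) → V → V → Bool
  class rep r x = ⌊ rep x ≟ r ⌋

  classPolynomial : (V → V) → V → ℕ → ℕ
  classPolynomial rep r = matchings (allFin n) (class rep r)

  alive-count : (V → Bool) → ℕ
  alive-count alive = ∑ (allFin n) (λ v → 𝟙 (alive v))

  -- rep maps every vertex to the surviving vertex into which it has been merged.
  record Invariant (i : ℕ) (K P : ℕ → ℕ) : Set where
    field
      alive    : V → Bool
      rep      : V → V
      alive≡   : ∀ v → K (toℕ v) ≡ 𝟙 (alive v)
      padding≡ : K n ≡ 0
      root     : alive origin ≡ true
      rep-alive : ∀ x → alive (rep x) ≡ true
      -- Each class is a module, and the quotient graph is the one induced by G on the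
      -- representatives.
      modular  : ∀ x y → rep x ≢ rep y → adj G x y ≡ adj G (rep x) (rep y)
      poly≡    : ∀ v → alive v ≡ true → ∀ {k} → k < m → P (m * toℕ v + k) ≡ classPolynomial rep v k
      -- A disjunction, because the number of survivors stops falling once only `origin` is left. At
      -- i = n + 1 the second alternative is impossible.
      progress : (∀ v → alive v ≡ true → v ≡ origin) ⊎ alive-count alive + i ≤ n

  open Invariant

  module _ {i K P} (inv : Invariant i K P) where

    open Search n (adjacency G) K

    alive⇒vertex : ∀ {w} → w < m → K w ≡ 1 → ∃ λ v → w ≡ toℕ v × alive inv v ≡ true
    alive⇒vertex {w} w<m Kw with m≤n⇒m<n∨m≡n (<m⇒≤n w<m)
    ... | inj₂ refl = ⊥-elim (1+n≢0 (trans (sym Kw) (padding≡ inv)))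
    ... | inj₁ w<n  = fromℕ< w<n , sym (toℕ-fromℕ< w<n) ,
      𝟙-injective (trans (sym (alive≡ inv (fromℕ< w<n))) (trans (cong K (toℕ-fromℕ< w<n)) Kw))

    agree⇒adj : ∀ {u v} → (∀ w → w < m → Agree (toℕ u) (toℕ v) w) →
      ∀ w → alive inv w ≡ true → w ≢ u → w ≢ v → adj G u w ≡ adj G v w
    agree⇒adj {u} {v} agree w aw w≢u w≢v = 𝟙-injective
      (trans (sym (adjacency-correct G u w))
        (trans (agree (toℕ w) (vertex<m w) (trans (alive≡ inv w) (cong 𝟙 aw))
                 (λ e → w≢u (toℕ-injective e)) (λ e → w≢v (toℕ-injective e)))
               (adjacency-correct G v w)))

    twins⇒twinsAt : ∀ {u v} → Twins G (alive inv) u v → v ≢ origin → TwinsAt (toℕ u) (toℕ v)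
    twins⇒twinsAt {u} {v} (au , av , u≢v , same) v≢0 =
      trans (alive≡ inv u) (cong 𝟙 au) , trans (alive≡ inv v) (cong 𝟙 av) ,
      (λ e → v≢0 (≡origin e)) , (λ e → u≢v (toℕ-injective e)) , agree
      where
      agree : ∀ w → w < m → Agree (toℕ u) (toℕ v) w
      agree w w<m Kw w≢u w≢v with alive⇒vertex w<m Kw
      ... | x , refl , ax = trans (adjacency-correct G u x) (trans
        (cong 𝟙 (same x ax (λ e → w≢u (cong toℕ e)) (λ e → w≢v (cong toℕ e))))
        (sym (adjacency-correct G v x)))

    -- The search ignores pairs whose second vertex is 0, but twinhood is symmetric and distinct
    -- twins cannot both be `origin`, so one of the two orders would have been found.
    no-twins⇒root : (∀ u v → u < m × v < m → ¬ TwinsAt u v) → ∀ v → alive inv v ≡ true → v ≡ origin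
    no-twins⇒root none with reducible cograph (alive inv)
    ... | empty e = ⊥-elim (false≢true (trans (sym (e origin)) (root inv)))
    ... | singleton u _ only = λ v av → trans (only v av) (sym (only origin (root inv)))
    ... | twins u v t@(au , av , u≢v , same) with v ≟ origin
    ...   | no v≢0  = ⊥-elim (none (toℕ u) (toℕ v) (vertex<m u , vertex<m v)
                        (twins⇒twinsAt t v≢0))
    ...   | yes v≡0 = ⊥-elim (none (toℕ v) (toℕ u) (vertex<m v , vertex<m u)
                        (twins⇒twinsAt (av , au , (λ e → u≢v (sym e)) ,
                            λ w aw w≢v w≢u → sym (same w aw w≢u w≢v))
                          (λ u≡0 → u≢v (trans u≡0 (sym v≡0)))))

    idle : (∀ v → alive inv v ≡ true → v ≡ origin) → Invariant (suc i) K P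
    idle only = record
      { alive = alive inv ; rep = rep inv ; alive≡ = alive≡ inv ; padding≡ = padding≡ inv
      ; root = root inv ; rep-alive = rep-alive inv ; modular = modular inv ; poly≡ = poly≡ inv
      ; progress = inj₁ only }

    module Merging {u v : V} (au : alive inv u ≡ true) (av : alive inv v ≡ true) (v≢0 : v ≢ origin)
      (u≢v : u ≢ v) (same : ∀ w → alive inv w ≡ true → w ≢ u → w ≢ v → adj G u w ≡ adj G v w) where

      newRep : V → V
      newRep x = if ⌊ rep inv x ≟ v ⌋ then u else rep inv x

      newRep-cases : ∀ x → (rep inv x ≡ v × newRep x ≡ u) ⊎ (rep inv x ≢ v × newRep x ≡ rep inv x)
      newRep-cases x with rep inv x ≟ v
      ... | yes e = inj₁ (e , refl)
      ... | no ne = inj₂ (ne , refl)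

      newAlive : V → Bool
      newAlive = alive inv ∖ v

      newRep-alive : ∀ x → newAlive (newRep x) ≡ true
      newRep-alive x with newRep-cases x
      ... | inj₁ (_ , e)  rewrite e = trans (∖-other (alive inv) u≢v) au
      ... | inj₂ (ne , e) rewrite e = trans (∖-other (alive inv) ne) (rep-alive inv x)

      adj-kept : ∀ y → rep inv y ≢ u → rep inv y ≢ v → adj G u (rep inv y) ≡ adj G v (rep inv y)
      adj-kept y = same (rep inv y) (rep-alive inv y)

      -- Something changes only if exactly one of x and y was in the class of v. The other
      -- representative is then neither u nor v, and the twin property replaces v by u.
      newModular : ∀ x y → newRep x ≢ newRep y → adj G x y ≡ adj G (newRep x) (newRep y)
      newModular x y ne with newRep-cases x | newRep-cases y
      ... | inj₁ (_ , e)    | inj₁ (_ , f)    = ⊥-elim (ne (trans e (sym f)))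
      ... | inj₂ (_ , e)    | inj₂ (_ , f)    =
        trans (modular inv x y λ h → ne (trans e (trans h (sym f)))) (cong₂ (adj G) (sym e) (sym f))
      ... | inj₁ (x≡v , e)  | inj₂ (y≢v , f)  =
        trans (modular inv x y λ h → y≢v (trans (sym h) x≡v))
          (trans (cong (λ z → adj G z (rep inv y)) x≡v)
            (trans (sym (adj-kept y (λ h → ne (trans e (sym (trans f h)))) y≢v))
              (cong₂ (adj G) (sym e) (sym f))))
      ... | inj₂ (x≢v , e)  | inj₁ (y≡v , f)  =
        trans (modular inv x y λ h → x≢v (trans h y≡v))
          (trans (cong (adj G (rep inv x)) y≡v)
            (trans (symm G (rep inv x) v)
              (trans (sym (adj-kept x (λ h → ne (trans e (trans h (sym f)))) x≢v))
                (trans (symm G u (rep inv x)) (cong₂ (adj G) (sym e) (sym f))))))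

      separated : Separated (adj G u v) (class (rep inv) u) (class (rep inv) v)
      separated = record
        { disjoint = λ {x} xu xv → u≢v (trans
            (sym (⌊⌋-witness (rep inv x ≟ u) xu)) (⌊⌋-witness (rep inv x ≟ v) xv))
        ; cross    = λ {x} {y} xu yv → cross′ (⌊⌋-witness (rep inv x ≟ u) xu) (⌊⌋-witness (rep inv y ≟ v) yv) }
        where
        cross′ : ∀ {x y} → rep inv x ≡ u → rep inv y ≡ v → adj G x y ≡ adj G u v
        cross′ {x} {y} x≡u y≡v = trans
          (modular inv x y λ h → u≢v (trans (sym x≡u) (trans h y≡v))) (cong₂ (adj G) x≡u y≡v)

      newClass-u : ∀ x → class newRep u x ≡ (class (rep inv) u ∪ class (rep inv) v) x
      newClass-u x with rep inv x ≟ v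
      ... | yes refl rewrite ⌊⌋-true (u ≟ u) refl | ⌊⌋-false (rep inv x ≟ u) (λ e → u≢v (sym e)) = refl
      ... | no _ with rep inv x ≟ u
      ...   | yes _ = refl
      ...   | no _  = refl

      newClass-other : ∀ {w} → w ≢ u → w ≢ v → ∀ x → class newRep w x ≡ class (rep inv) w x
      newClass-other {w} w≢u w≢v x with rep inv x ≟ v
      ... | no _ = refl
      ... | yes refl rewrite ⌊⌋-false (u ≟ w) (λ e → w≢u (sym e))
                           | ⌊⌋-false (rep inv x ≟ w) (λ e → w≢v (sym e)) = refl

      product≡ : ∀ k →
        crossingProduct (adj G u v) m (classPolynomial (rep inv) u) (classPolynomial (rep inv) v) k ≡
                 classPolynomial newRep u k
      product≡ k = trans
        (trans (cong (λ m → crossingProduct (adj G u v) m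
                (classPolynomial (rep inv) u) (classPolynomial (rep inv) v) k) m≡)
          (sym (matchings-∪ (adj G u v) n (allFin⁺ n)
            (≤-reflexive (length-tabulate {n = n} (λ x → x))) separated k)))
        (matchings-cong (allFin n) (λ {x} _ → sym (newClass-u x)) k)

      count-decreases : alive-count newAlive < alive-count (alive inv)
      count-decreases = ∑-mono-< weaken (∈-allFin v) strict
        where
        weaken : ∀ w → 𝟙 (newAlive w) ≤ 𝟙 (alive inv w)
        weaken w with alive inv w | ⌊ w ≟ v ⌋
        ... | true  | true  = z≤n
        ... | true  | false = ≤-refl
        ... | false | _     = z≤n
        strict : 𝟙 (newAlive v) < 𝟙 (alive inv v)
        strict rewrite ∖-self (alive inv) v | av = s≤s z≤n

      merged-invariant : ∀ {σ τ} → narr σ #poly ≡ P → narr σ #alive ≡ K →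
        Merged (adj G u v) (toℕ u) (toℕ v) (classPolynomial (rep inv) u) (classPolynomial (rep inv) v) σ τ →
        Invariant (suc i) (narr τ #alive) (narr τ #poly)
      merged-invariant {σ} {τ} refl refl merged = record
        { alive = newAlive ; rep = newRep ; alive≡ = newAlive≡
        ; padding≡ = trans (surviving (λ e → <-irrefl (sym e) (toℕ<n v))) (padding≡ inv)
        ; root = trans (∖-other (alive inv) (λ e → v≢0 (sym e))) (root inv)
        ; rep-alive = newRep-alive ; modular = newModular ; poly≡ = newPoly≡
        ; progress = newProgress (progress inv) }
        where
        open Merged merged
        newAlive≡ : ∀ w → narr τ #alive (toℕ w) ≡ 𝟙 (newAlive w)
        newAlive≡ w with w ≟ v
        ... | yes refl = trans killed (cong 𝟙 (sym (∧-zeroʳ (alive inv w))))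
        ... | no w≢v   = trans (surviving λ e → w≢v (toℕ-injective e))
          (trans (alive≡ inv w) (cong 𝟙 (sym (∧-identityʳ (alive inv w)))))
        newPoly≡ : ∀ w → newAlive w ≡ true → ∀ {k} → k < m →
                   narr τ #poly (m * toℕ w + k) ≡ classPolynomial newRep w k
        newPoly≡ w aw {k} k<m with w ≟ u
        ... | yes refl = trans (product k<m) (product≡ k)
        ... | no w≢u   = trans (others (λ e → w≢u (toℕ-injective e)) k<m)
          (trans (poly≡ inv w (∖-⊆ (alive inv) v aw) k<m)
            (matchings-cong (allFin n) (λ {x} _ → sym (newClass-other w≢u w≢v x)) k))
          where
          w≢v : w ≢ v
          w≢v refl with () ← trans (sym aw) (∖-self (alive inv) w)
        newProgress : (∀ w → alive inv w ≡ true → w ≡ origin) ⊎ alive-count (alive inv) + i ≤ n →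
                      (∀ w → newAlive w ≡ true → w ≡ origin) ⊎ alive-count newAlive + suc i ≤ n
        -- A survivor v other than `origin` shows that the elimination was not finished.
        newProgress (inj₁ only) = ⊥-elim (v≢0 (only v av))
        newProgress (inj₂ l)    = inj₂ (≤-trans (≤-reflexive (+-suc _ i))
          (≤-trans (+-monoˡ-≤ i count-decreases) l))

  -- One round of the elimination

  record Input (σ : Store) : Set where
    field
      M≡   : nvar σ #M ≡ m
      N≡   : nvar σ #N ≡ n
      adj≡ : narr σ #adj ≡ adjacency G

  Kept : ℕ → Store → Set
  Kept i τ = Invariant i (narr τ #alive) (narr τ #poly)

  -- τ stands for the store after the search; the actual term would be
  -- unfolded at great expense.
  module _ {i} {σ τ : Store} (input : Input σ) (inv : Kept i σ) (ch : Unchanged search σ τ) where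

    open Input input
    open Search n (adjacency G) (narr σ #alive)

    kept : (∀ u v → u < m × v < m → ¬ TwinsAt u v) → Kept (suc i) τ
    kept none = subst₂ (Invariant (suc i)) (sym (arrays ch #alive)) (sym (arrays ch #poly))
      (idle inv (no-twins⇒root inv none))

    row : ∀ w → alive inv w ≡ true → ∀ a → a < m →
      narr τ #poly (m * toℕ w + a) ≡ classPolynomial (rep inv) w a
    row w aw a a<m = trans (cong (λ f → f (m * toℕ w + a)) (arrays ch #poly)) (poly≡ inv w aw a<m)

    edge≡ : ∀ u v → nvar τ #fu ≡ toℕ u → nvar τ #fv ≡ toℕ v → eval (adjAt #fu #fv) τ ≡ 𝟙 (adj G u v)
    edge≡ u v fu≡ fv≡ = trans
      (cong₂ (λ A N → A (N * nvar τ #fu + nvar τ #fv)) (trans (arrays ch #adj) adj≡) (trans (vars ch #N) N≡))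
      (trans (cong₂ (λ x y → adjacency G (n * x + y)) fu≡ fv≡) (adjacency-correct G u v))

    merged : ∀ τ′ → (∀ {c u v P Q} → nvar τ #fu ≡ u → nvar τ #fv ≡ v →
        eval (adjAt #fu #fv) τ ≡ 𝟙 c →
        (∀ a → a < m → narr τ #poly (m * u + a) ≡ P a) →
        (∀ b → b < m → narr τ #poly (m * v + b) ≡ Q b) → Merged c u v P Q τ τ′) →
      nvar τ #fu < m → nvar τ #fv < m → TwinsAt (nvar τ #fu) (nvar τ #fv) → Kept (suc i) τ′
    merged τ′ merging fu<m fv<m (Ku , Kv , v≢0 , u≢v , agree)
      with alive⇒vertex inv fu<m Ku | alive⇒vertex inv fv<m Kv
    ... | u , fu≡ , au | v , fv≡ , av = Merging.merged-invariant inv au av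
      (λ v≡0 → v≢0 (trans fv≡ (trans (cong toℕ v≡0) origin≡0)))
      (λ u≡v → u≢v (trans fu≡ (trans (cong toℕ u≡v) (sym fv≡))))
      (agree⇒adj inv (subst₂ (λ x y → ∀ w → w < m → Agree x y w) fu≡ fv≡ agree))
      {τ} {τ′} (arrays ch #poly) (arrays ch #alive)
      (merging fu≡ fv≡ (edge≡ u v fu≡ fv≡) (row u au) (row v av))

    yes-branch : Outcome (λ u v → u < m × v < m) τ → nvar τ #found ≡ 1 → Kept (suc i) (exec m merge τ)
    yes-branch (found _ fu< fv< t) _ =
      merged (exec m merge τ) (merge-correct τ (trans (vars ch #M) M≡)) fu< fv< t
    yes-branch (missing f _)       e = ⊥-elim (1+n≢0 (trans (sym e) f))

    no-branch : Outcome (λ u v → u < m × v < m) τ → nvar τ #found ≢ 1 → Kept (suc i) τ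
    no-branch (found f _ _ _) ne = ⊥-elim (ne f)
    no-branch (missing _ none) _ = kept none

  eliminate-correct : ∀ {i} σ → Input σ → Kept i σ → Kept (suc i) (exec m eliminate σ)
  eliminate-correct {i} σ input inv =
    exec-⨾-ifEq m {t = get #found} {num 1} {search} {merge} {nop} (Kept (suc i)) σ
      (yes-branch {i} {σ} {exec m search σ} input inv ch outcome)
      (no-branch {i} {σ} {exec m search σ} input inv ch outcome)
    where
    open Input input
    ch : Unchanged search σ (exec m search σ)
    ch = exec-unchanged m search σ
    outcome : Search.Outcome n (adjacency G) (narr σ #alive) (λ u v → u < m × v < m) (exec m search σ)
    outcome = Search.search-correct n (adjacency G) (narr σ #alive) σ
      (record { N≡ = N≡ ; A≡ = adj≡ ; K≡ = refl })

  -- The initial polynomials, the whole run and the answer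

  matchings-outside : ∀ xs S → (∀ {x} → x ∈ xs → S x ≡ false) → ∀ k → matchings xs S k ≡ 𝟙 (0 ≡ᵇ k)
  matchings-outside []       S out zero    = refl
  matchings-outside []       S out (suc k) = refl
  matchings-outside (x ∷ xs) S out k =
    trans (matchings-out x xs S k (out (here refl))) (matchings-outside xs S (λ x∈ → out (there x∈)) k)

  matchings-singleton : ∀ {xs v} → Unique xs → v ∈ xs → ∀ k →
    matchings xs (λ x → ⌊ x ≟ v ⌋) k ≡ 𝟙 (k ≡ᵇ 1)
  matchings-singleton {x ∷ xs} {v} (x≢xs ∷ _) (here refl) k =
    trans (matchings-in x xs S k (⌊⌋-true (v ≟ v) refl))
      (trans (cong₂ _+_ (shift-cong (matchings-outside xs S out) k) no-partners) (value k))
    where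
    S : V → Bool
    S x = ⌊ x ≟ v ⌋
    out : ∀ {y} → y ∈ xs → S y ≡ false
    out {y} y∈ = ⌊⌋-false (y ≟ v) λ e → All.lookup x≢xs y∈ (sym e)
    no-partners : partners x xs S k ≡ 0
    no-partners = trans
      (∑-cong-∈ xs λ {y} y∈ → cong (λ b → 𝟙 (b ∧ adj G x y) * matchings xs (S ∖ y) k) (out y∈))
      (∑-zero xs)
    value : ∀ k → shift (λ k → 𝟙 (0 ≡ᵇ k)) k + 0 ≡ 𝟙 (k ≡ᵇ 1)
    value zero          = refl
    value (suc zero)    = refl
    value (suc (suc k)) = refl
  matchings-singleton {x ∷ xs} {v} (x≢xs ∷ u) (there v∈) k =
    trans (matchings-out x xs _ k (⌊⌋-false (x ≟ v) (All.lookup x≢xs v∈))) (matchings-singleton u v∈ k)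

  -- Only one coefficient per row is written, so the invariant must remember that the rows ahead are
  -- still blank.
  record Initialised (i : ℕ) (K P : ℕ → ℕ) : Set where
    field
      ones  : ∀ {v} → v < i → K v ≡ 1
      units : ∀ {v k} → v < i → k < m → P (m * v + k) ≡ 𝟙 (k ≡ᵇ 1)
      zeros : ∀ {j} → m * i ≤ j → P j ≡ 0

  initialised-step : ∀ {i K P u j} → i < m → u ≡ i → j ≡ m * i + 1 → Initialised i K P →
    Initialised (suc i) (update ℕ._≟_ K u 1) (update ℕ._≟_ P j 1)
  initialised-step {i} {K} {P} i<m refl refl init = record
    { ones  = λ {v} v≤i → ones′ v (m≤n⇒m<n∨m≡n (s≤s⁻¹ v≤i))
    ; units = λ {v} {k} v≤i k<m → units′ v k (m≤n⇒m<n∨m≡n (s≤s⁻¹ v≤i)) k<m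
    ; zeros = λ {j} l → trans (update-other P 1 (λ e → <⇒≢ (<-≤-trans next l) (sym e)))
                              (zeros (≤-trans (*-monoʳ-≤ m (n≤1+n i)) l)) }
    where
    open Initialised init
    -- The existence of `origin` gives n ≥ 1; for m = 1 the coefficient at index 1 would land in the
    -- next row.
    1<m : 1 < m
    1<m = subst (1 <_) (sym m≡) (s≤s (≤-<-trans z≤n (toℕ<n origin)))
    next : m * i + 1 < m * suc i
    next = <-≤-trans (block-< m (n<1+n i) 1<m) (≤-reflexive (+-identityʳ (m * suc i)))
    ones′ : ∀ v → v < i ⊎ v ≡ i → update ℕ._≟_ K i 1 v ≡ 1
    ones′ v (inj₂ refl) = update-same K v 1
    ones′ v (inj₁ v<i)  = trans (update-other K 1 (<⇒≢ v<i)) (ones v<i)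
    units′ : ∀ v k → v < i ⊎ v ≡ i → k < m →
             update ℕ._≟_ P (m * i + 1) 1 (m * v + k) ≡ 𝟙 (k ≡ᵇ 1)
    units′ v k (inj₁ v<i) k<m =
      trans (update-other P 1 (<⇒≢ (block-< m v<i k<m))) (units v<i k<m)
    units′ v zero (inj₂ refl) k<m =
      trans (update-other P 1 λ e → 1+n≢0 (sym (+-cancelˡ-≡ (m * v) 0 1 e))) (zeros (m≤m+n (m * v) 0))
    units′ v (suc zero) (inj₂ refl) k<m = update-same P (m * v + 1) 1
    units′ v (suc (suc k)) (inj₂ refl) k<m =
      trans (update-other P 1 λ e → 1+n≢0 (suc-injective (+-cancelˡ-≡ (m * v) (suc (suc k)) 1 e)))
        (zeros (m≤m+n (m * v) (suc (suc k))))

  initialise-correct : ∀ σ → Input σ → (∀ j → narr σ #poly j ≡ 0) → Kept 0 (exec m initialise σ)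
  initialise-correct σ input blank = record
    { alive     = λ _ → true
    ; rep       = λ v → v
    ; alive≡    = λ v → trans (update-other (narr τ #alive) 0 (λ e → <⇒≢ (toℕ<n v) (trans e N₌)))
                          (ones (vertex<m v))
    ; padding≡  = trans (cong (λ z → update ℕ._≟_ (narr τ #alive) z 0 n) N₌) (update-same (narr τ #alive) n 0)
    ; root      = refl
    ; rep-alive = λ _ → refl
    ; modular   = λ _ _ _ → refl
    ; poly≡     = λ v _ {k} k<m → trans (units (vertex<m v) k<m)
                    (sym (matchings-singleton (allFin⁺ n) (∈-allFin v) k))
    ; progress  = inj₂ (≤-reflexive (trans (+-identityʳ _)
                    (trans (∑-one (allFin n)) (length-tabulate {n = n} (λ x → x))))) }
    where
    open Input input
    loop : Stmt 4
    loop = for #u initialiseVertex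
    τ = exec m loop σ
    N₌ : nvar τ #N ≡ n
    N₌ = trans (vars (exec-unchanged m loop σ) #N) N≡
    filled : Initialised m (narr τ #alive) (narr τ #poly)
    filled = exec-for m #u initialiseVertex σ (λ i τ → Initialised i (narr τ #alive) (narr τ #poly))
      (record { ones = λ () ; units = λ () ; zeros = λ {j} _ → blank j })
      λ i τ i<m i≡ ch → initialised-step i<m i≡
        (cong₂ (λ x y → x * y + 1) (trans (vars ch #M) M≡) i≡)
    open Initialised filled

  eliminateAll-correct : ∀ σ → Input σ → Kept 0 σ → Kept m (exec m eliminateAll σ)
  eliminateAll-correct σ input inv = exec-for m #step eliminate σ Kept inv
    λ i τ i<m i≡ ch kept → eliminate-correct τ (record
      { M≡   = trans (vars ch #M) (Input.M≡ input)
      ; N≡   = trans (vars ch #N) (Input.N≡ input)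
      ; adj≡ = trans (arrays ch #adj) (Input.adj≡ input) }) kept

  -- After m = n + 1 rounds only `origin` survives, so its class contains every vertex, and its
  -- coefficient 0 counts the matchings that leave nothing uncovered.
  answer : ∀ {K P} → Invariant m K P → P 0 ≡ length (perfectMatchings G)
  answer {K} {P} inv = trans (cong P (sym
      (trans (cong (λ z → m * z + 0) origin≡0) (trans (+-identityʳ (m * 0)) (*-zeroʳ m)))))
    (trans (poly≡ inv origin (root inv) (≤-<-trans z≤n (vertex<m origin)))
      (trans (matchings-cong (allFin n)
          (λ {x} _ → ⌊⌋-true (rep inv x ≟ origin) (only (rep inv x) (rep-alive inv x))) 0)
        (sym (Edges.perfectMatchings-count G))))
    where
    only : ∀ v → alive inv v ≡ true → v ≡ origin
    only with progress inv
    ... | inj₁ o = o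
    ... | inj₂ l = ⊥-elim (1+n≰n (≤-trans (≤-reflexive (sym m≡)) (≤-trans (m≤n+m m (alive-count (alive inv))) l)))

  eliminated : ∀ σ → Unchanged initialise (inputStore G) σ → Kept 0 σ → Kept m (exec m eliminateAll σ)
  eliminated σ ch = eliminateAll-correct σ
    (record { M≡ = trans (vars ch #M) (sym m≡) ; N≡ = vars ch #N ; adj≡ = arrays ch #adj })

  countMatchings-correct : nvar (exec m countMatchings (inputStore G)) #N ≡ length (perfectMatchings G)
  countMatchings-correct = trans (countMatchings-output m (inputStore G))
    (output {exec m eliminateAll (exec m initialise (inputStore G))} (eliminated
      (exec m initialise (inputStore G)) (exec-unchanged m initialise (inputStore G))
      (initialise-correct (inputStore G) (record { M≡ = sym m≡ ; N≡ = refl ; adj≡ = refl }) (λ _ → refl))))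
    where
    output : ∀ {τ} → Kept m τ → narr τ #poly 0 ≡ length (perfectMatchings G)
    output {τ} inv = answer {narr τ #alive} {narr τ #poly} inv

-- The complete program and its running time

cographProgram : Program
cographProgram = #M ≔ ` #N ⊕ lit (+ 1) ⨟ compile countMatchings

-- The 4 pays for computing n + 1 at the start; the exponent is the loop depth of `countMatchings`.
runningTime : ℕ → ℕ
runningTime n = 4 + work countMatchings * suc n ^ 4

runningTime-O : runningTime ∈O (λ n → n ^ 4)
-- For n ≥ 1 one has n + 1 ≤ 2n, and 16 is 2 ^ 4.
runningTime-O = 4 + work countMatchings * 16 , 1 , bound
  where
  open ≤-Reasoning
  double-^4 : ∀ n → 2 * n * (2 * n * (2 * n * (2 * n * 1))) ≡ 16 * (n * (n * (n * (n * 1))))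
  double-^4 = solve-∀
  bound : ∀ n → 1 ≤ n → runningTime n ≤ (4 + work countMatchings * 16) * n ^ 4
  bound n@(suc _) 1≤n = begin
    4 + work countMatchings * suc n ^ 4              ≤⟨ +-mono-≤ (m≤m*n 4 (n ^ 4) ⦃ m^n≢0 n 4 ⦄)
                                                         (*-monoʳ-≤ (work countMatchings) (^-monoˡ-≤ 4 (+-mono-≤ 1≤n (m≤m+n n 0)))) ⟩
    4 * n ^ 4 + work countMatchings * (2 * n) ^ 4    ≡⟨ cong (λ z → 4 * n ^ 4 + work countMatchings * z) (double-^4 n) ⟩
    4 * n ^ 4 + work countMatchings * (16 * n ^ 4)   ≡⟨ cong (λ z → 4 * n ^ 4 + z) (*-assoc (work countMatchings) 16 (n ^ 4)) ⟨
    4 * n ^ 4 + work countMatchings * 16 * n ^ 4     ≡⟨ *-distribʳ-+ (n ^ 4) 4 (work countMatchings * 16) ⟨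
    (4 + work countMatchings * 16) * n ^ 4           ∎

represents-input : ∀ {n} (G : Graph (Fin n)) →
  Represents (inputStore G) (setVar #M (+ n ℤ.+ + 1) (initial G))
represents-input {n} G = record { var≡ = v ; arr≡ = a }
  where
  v : ∀ x → var (setVar #M (+ n ℤ.+ + 1) (initial G)) x ≡ + nvar (inputStore G) x
  v zero          = refl
  v (suc zero)    = cong +_ (+-comm n 1)
  v (suc (suc _)) = refl
  a : ∀ b i → arr (initial G) b (+ i) ≡ + narr (inputStore G) b i
  a zero    i = adjacency-pos G i
  a (suc _) i = refl

compile-computes : ∀ {d} (p : Stmt d) → LoopsOk p → Untouched #M p → ∀ {n} (G : Graph (Fin n)) {z} →
  nvar (exec (suc n) p (inputStore G)) #N ≡ z →
  (#M ≔ ` #N ⊕ lit (+ 1) ⨟ compile p) on G Computes (+ z) Within (4 + work p * suc n ^ d)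
compile-computes p ok untouched {n} G z≡
  with simulated {s} {t} run r b ← compile-correct n p ok untouched (represents-input G) refl =
  s , 4 + t , ⇓seq ⇓var run , trans (Represents.var≡ r #N) (cong +_ z≡) , +-monoʳ-≤ 4 b

first : ∀ {n} → Fin n → ∃ λ (i : Fin n) → toℕ i ≡ 0
first {suc n} _ = zero , refl

cographProgram-correct : ∀ n (G : Graph (Fin n)) → Cograph G →
  cographProgram on G Computes (+ length (perfectMatchings G)) Within runningTime n
cographProgram-correct n G cograph with origin , origin≡0 ← first (inhabited cograph) =
  -- Both side conditions compute to products of `⊤`s.
  compile-computes countMatchings _ _ G
    (Elimination.countMatchings-correct G cograph origin origin≡0 (suc n) refl)

mainTheorem5 : ∃₂ λ (p : Program) (time : ℕ → ℕ) →
    time ∈O (λ n → n ^ 4) ×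
    (∀ n (G : Graph (Fin n)) → Cograph G →
    p on G Computes (+ length (perfectMatchings G)) Within time n)
mainTheorem5 = cographProgram , runningTime , runningTime-O , cographProgram-correct
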